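{- Let $G=(V,E)$ be a 2-edge-connected undirected multigraph and let $E'\subseteq E$ be a minimal 2-edge-connected spanning subgraph of $G$ (i.e., $(V,E')$ is 2-edge-connected and no proper subset of $E'$ spanning $V$ is). Let $F\subseteq E$ be an edge set forming a (not necessarily spanning) forest in $G$ such that every edge $e\in E'\setminus F$ is essential in $(V,E'\cup F)$. Let $L_0:=V\setminus V(F)$, $L_1:=\{v\in V(F)\mid \deg_F(v)=1,\ \delta_F(v)\subseteq E'\}$, $L_2:=\{v\in V(F)\mid \deg_F(v)=1,\ \delta_F(v)\cap E'=\varnothing\}$, and $L:=L_0\cup L_1\cup L_2$. Then $$\sum_{v\in L}\deg_{E'}(v)\;\le\;3\,(|L|+|L_0|)+|L_1|.$$
   Context: A multigraph (parallel edges allowed, edges identified by name) is 2-edge-connected if for every edge $e$ the graph obtained by deleting $e$ is connected. In a 2-edge-connected multigraph $H$, an edge $e$ is essential if $H$ with $e$ deleted is not 2-edge-connected. For an edge set $H$, $V(H)$ is the set of nodes incident to edges of $H$, $\delta_H(v)$ is the set of edges of $H$ incident to $v$, and $\deg_H(v):=|\delta_H(v)|$. -}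

module Defs where

open import Data.Nat using (ℕ; zero; suc; _+_; _*_; _≤_)
open import Data.Bool using (Bool; true; false; _∧_; _∨_; not; if_then_else_)
open import Data.Fin using (Fin; _≟_)
open import Data.Fin.Subset using (Subset; _∈_; _∉_; _⊆_; _⊂_; _∩_; _-_; ∣_∣; ⊤; outside)
open import Data.Fin.Subset.Properties using (_∈?_; _⊆?_; nonempty?)
open import Data.Vec using (tabulate; lookup)
open import Data.List using (List; []; _∷_; map; allFin)
open import Data.Nat.ListAction using (sum)
open import Data.List.Relation.Unary.Unique.Propositional using (Unique)
open import Data.Product using (_×_; _,_; proj₁; proj₂; Σ; ∃)
open import Relation.Nullary using (¬_)
open import Relation.Nullary.Decidable using (⌊_⌋)
open import Relation.Binary.PropositionalEquality using (_≡_)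

-- A finite undirected multigraph: nodes Fin n, edges Fin m (edges are named),
-- each edge has an (unordered) pair of endpoints; parallel edges and loops allowed.
record Multigraph : Set where
  field
    n    : ℕ
    m    : ℕ
    ends : Fin m → Fin n × Fin n

open Multigraph public

EdgeSet : Multigraph → Set
EdgeSet G = Subset (m G)

NodeSet : Multigraph → Set
NodeSet G = Subset (n G)

incident : (G : Multigraph) → Fin (m G) → Fin (n G) → Bool
incident G e v = ⌊ proj₁ (ends G e) ≟ v ⌋ ∨ ⌊ proj₂ (ends G e) ≟ v ⌋

δ : (G : Multigraph) → EdgeSet G → Fin (n G) → EdgeSet G
δ G H v = tabulate (λ e → lookup H e ∧ incident G e v)

deg : (G : Multigraph) → EdgeSet G → Fin (n G) → ℕ
deg G H v = ∣ δ G H v ∣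

data Walk (G : Multigraph) (H : EdgeSet G) : Fin (n G) → Fin (n G) → List (Fin (m G)) → Set where
  nil  : ∀ {v} → Walk G H v v []
  fwd  : ∀ {w es} (e : Fin (m G)) → e ∈ H →
         Walk G H (proj₂ (ends G e)) w es → Walk G H (proj₁ (ends G e)) w (e ∷ es)
  bwd  : ∀ {w es} (e : Fin (m G)) → e ∈ H →
         Walk G H (proj₁ (ends G e)) w es → Walk G H (proj₂ (ends G e)) w (e ∷ es)

Connected : (G : Multigraph) → EdgeSet G → Set
Connected G H = ∀ (u v : Fin (n G)) → ∃ λ es → Walk G H u v es

TwoEdgeConnected : (G : Multigraph) → EdgeSet G → Set
TwoEdgeConnected G H = Connected G H × (∀ e → e ∈ H → Connected G (H - e))

Essential : (G : Multigraph) → EdgeSet G → Fin (m G) → Set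
Essential G H e = ¬ TwoEdgeConnected G (H - e)

Minimal2ECSS : (G : Multigraph) → EdgeSet G → Set
Minimal2ECSS G E' = TwoEdgeConnected G E' × (∀ S → S ⊂ E' → ¬ TwoEdgeConnected G S)

-- A cycle in H: a nonempty closed walk in H with pairwise distinct edges
-- (a loop is a cycle of length 1, two parallel edges form a cycle of length 2)
HasCycle : (G : Multigraph) → EdgeSet G → Set
HasCycle G H = Σ (Fin (n G)) λ v → Σ (Fin (m G)) λ e → Σ (List (Fin (m G))) λ es →
  Walk G H v v (e ∷ es) × Unique (e ∷ es)

Forest : (G : Multigraph) → EdgeSet G → Set
Forest G F = ¬ HasCycle G F

_==1 : ℕ → Bool
zero ==1 = false
suc zero ==1 = true
suc (suc _) ==1 = false

_==0 : ℕ → Bool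
zero ==0 = true
suc _ ==0 = false

-- L₀ := V ∖ V(F)   (v ∉ V(F) iff deg_F(v) = 0)
L₀ : (G : Multigraph) → (E' F : EdgeSet G) → NodeSet G
L₀ G E' F = tabulate λ v → deg G F v ==0

L₁ : (G : Multigraph) → (E' F : EdgeSet G) → NodeSet G
L₁ G E' F = tabulate λ v → (deg G F v ==1) ∧ ⌊ δ G F v ⊆? E' ⌋

L₂ : (G : Multigraph) → (E' F : EdgeSet G) → NodeSet G
L₂ G E' F = tabulate λ v → (deg G F v ==1) ∧ not ⌊ nonempty? (δ G F v ∩ E') ⌋

L : (G : Multigraph) → (E' F : EdgeSet G) → NodeSet G
L G E' F = tabulate λ v → lookup (L₀ G E' F) v ∨ (lookup (L₁ G E' F) v ∨ lookup (L₂ G E' F) v)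

sumOver : (G : Multigraph) → NodeSet G → (Fin (n G) → ℕ) → ℕ
sumOver G S f = sum (map (λ v → if lookup S v then f v else 0) (allFin (n G)))

{-# OPTIONS --safe #-}
module Submission where

-- Put H = E' ∪ F, extend F to a spanning tree T of H, and let D₁ = T ∖ F, D₂ = H ∖ T.
-- The nodes of L are exactly those with deg_F ≤ 1, and the E'-edges outside F lie in D₁ ∪ D₂.
-- D₁ is small because |D₁| + |F| ≤ n, while 2n − Σ deg_F ≤ |L| + |L₀|.
-- Every e ∈ D₂ lies in a 2-edge cut {e , φ e} of H with φ e ∈ T. The T-path joining the ends
-- of e contains φ e but no φ e′ with e′ ≠ e; hence φ is injective, T ∖ φ(D₂) has at least |D₂|
-- components, and e joins the same two components as φ e. A component K disjoint from L has
-- deg_F ≥ 2 everywhere, so the forest F has at least two edges leaving K; each of them is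
-- some φ e, hence K meets D₂ at least twice. Counting components by whether they meet L gives
-- Σ_{v ∈ L} deg_{D₂}(v) ≤ 2|L|.

open import Defs
open import Data.Bool using (true; false; _∧_; _∨_; not; if_then_else_)
open import Data.Fin using (Fin; zero; suc; _≟_)
open import Data.Fin.Properties using (any?; all?; suc-injective)
open import Data.Fin.Subset using (Subset; _∈_; _∉_; _⊆_; _∪_; _∩_; _─_; _-_; ⁅_⁆; ∣_∣; ⊤)
open import Data.Fin.Subset.Properties
open import Data.List as List using (List; []; _∷_; allFin; filter; length)
open import Data.List.Membership.Propositional using () renaming (_∈_ to _∈ₗ_)
open import Data.List.Membership.Propositional.Properties using (∈-filter⁺; ∈-filter⁻; ∈-allFin)
open import Data.List.Properties using (map-tabulate)
open import Data.List.Relation.Unary.All as All using ()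
open import Data.List.Relation.Unary.All.Properties using (¬Any⇒All¬)
open import Data.List.Relation.Unary.AllPairs using ([]; _∷_)
open import Data.List.Relation.Unary.Any using (here; there)
open import Data.List.Relation.Unary.Unique.Propositional using (Unique)
open import Data.List.Relation.Unary.Unique.Propositional.Properties using (allFin⁺; filter⁺)
open import Data.Nat using (ℕ; zero; suc; _+_; _*_; _≤_; z≤n; s≤s)
open import Data.Nat.ListAction as ListAction using ()
open import Data.Nat.Properties hiding (_≟_; suc-injective)
open import Data.Nat.Tactic.RingSolver using (solve-∀)
open import Algebra.Properties.Semiring.Sum +-*-semiring using (sum; sum-cong-≗; ∑-distrib-+; ∑-comm; *-distribˡ-sum; *-distribʳ-sum; sum-replicate-zero)
open import Data.Product using (_×_; _,_; proj₁; proj₂; ∃)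
open import Data.Sum using (_⊎_; inj₁; inj₂; map₂)
open import Data.Vec using ([]; _∷_; lookup; tabulate; here; there)
open import Data.Vec.Properties using (lookup∘tabulate; lookup⇒[]=; []=⇒lookup)
open import Function using (_∘_; id)
open import Relation.Binary.PropositionalEquality
open import Relation.Nullary using (Dec; yes; no; ¬_; does; contradiction; ¬?; _×-dec_; _⊎-dec_)
open import Relation.Nullary.Decidable using (map′; ⌊_⌋; dec-true; dec-false; decidable-stable)
open import Relation.Unary using (Decidable)

-- Iverson brackets, finite sums and decidable subsets.

private variable
  P Q : Set

⟦_⟧ : Dec P → ℕ
⟦ yes _ ⟧ = 1
⟦ no _ ⟧ = 0

⟦⟧-yes : (P? : Dec P) → P → ⟦ P? ⟧ ≡ 1
⟦⟧-yes (yes _) _ = refl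
⟦⟧-yes (no ¬p) p = contradiction p ¬p

⟦⟧-no : (P? : Dec P) → ¬ P → ⟦ P? ⟧ ≡ 0
⟦⟧-no (yes p) ¬p = contradiction p ¬p
⟦⟧-no (no _) _ = refl

⟦⟧-mono : (P? : Dec P) (Q? : Dec Q) → (P → Q) → ⟦ P? ⟧ ≤ ⟦ Q? ⟧
⟦⟧-mono (no _) Q? f = z≤n
⟦⟧-mono (yes p) Q? f = ≤-reflexive (sym (⟦⟧-yes Q? (f p)))

⟦⟧-cong : (P? : Dec P) (Q? : Dec Q) → (P → Q) → (Q → P) → ⟦ P? ⟧ ≡ ⟦ Q? ⟧
⟦⟧-cong P? Q? f g = ≤-antisym (⟦⟧-mono P? Q? f) (⟦⟧-mono Q? P? g)

∑-mono : ∀ {k} {f g : Fin k → ℕ} → (∀ i → f i ≤ g i) → sum f ≤ sum g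
∑-mono {zero} f≤g = z≤n
∑-mono {suc k} f≤g = +-mono-≤ (f≤g zero) (∑-mono (f≤g ∘ suc))

term≤∑ : ∀ {k} (f : Fin k → ℕ) i → f i ≤ sum f
term≤∑ f zero = m≤m+n _ _
term≤∑ f (suc i) = ≤-trans (term≤∑ (f ∘ suc) i) (m≤n+m _ _)

∑-zero : ∀ {k} (f : Fin k → ℕ) → (∀ i → f i ≡ 0) → sum f ≡ 0
∑-zero {k} f f≡0 = trans (sum-cong-≗ f≡0) (sum-replicate-zero k)

∑-const : ∀ k c → sum {k} (λ _ → c) ≡ k * c
∑-const zero c = refl
∑-const (suc k) c = cong (c +_) (∑-const k c)

-- Applied to a constant `f`, this expands a term into a sum over the values of a map such as `φ` or
-- `component`. Exchanging the two sums then groups the terms by fibres.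
∑-point : ∀ {k} (f : Fin k → ℕ) i → sum (λ j → f j * ⟦ i ≟ j ⟧) ≡ f i
∑-point f zero = begin
  f zero * 1 + sum (λ j → f (suc j) * 0) ≡⟨ cong₂ _+_ (*-identityʳ _) (∑-zero _ (λ j → *-zeroʳ (f (suc j)))) ⟩
  f zero + 0                             ≡⟨ +-identityʳ _ ⟩
  f zero                                 ∎
  where open ≡-Reasoning
∑-point f (suc i) = begin
  f zero * 0 + sum (λ j → f (suc j) * ⟦ suc i ≟ suc j ⟧) ≡⟨ cong (_+ sum (λ j → f (suc j) * ⟦ suc i ≟ suc j ⟧)) (*-zeroʳ (f zero)) ⟩
  sum (λ j → f (suc j) * ⟦ suc i ≟ suc j ⟧)
    ≡⟨ sum-cong-≗ (λ j → cong (f (suc j) *_) (⟦⟧-cong (suc i ≟ suc j) (i ≟ j) suc-injective (cong suc))) ⟩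
  sum (λ j → f (suc j) * ⟦ i ≟ j ⟧)                      ≡⟨ ∑-point (f ∘ suc) i ⟩
  f (suc i)                                              ∎
  where open ≡-Reasoning

∑-single : ∀ {k} (i : Fin k) → sum (λ j → ⟦ i ≟ j ⟧) ≡ 1
∑-single {k} i = trans (sum-cong-≗ {k} (λ j → sym (+-identityʳ ⟦ i ≟ j ⟧))) (∑-point (λ _ → 1) i)

∑-unique : ∀ {k} {P : Fin k → Set} (P? : Decidable P) → (∀ {i j} → P i → P j → i ≡ j) → sum (λ i → ⟦ P? i ⟧) ≤ 1
∑-unique {zero} P? uniq = z≤n
∑-unique {suc k} P? uniq with P? zero
... | no _ = ∑-unique (P? ∘ suc) (λ p q → suc-injective (uniq p q))
... | yes p = s≤s (≤-reflexive (∑-zero _ λ i → ⟦⟧-no (P? (suc i)) λ q → contradiction (uniq p q) λ ()))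

sum-map-allFin : ∀ {k} (f : Fin k → ℕ) → ListAction.sum (List.map f (allFin k)) ≡ sum f
sum-map-allFin {k} f = trans (cong ListAction.sum (map-tabulate id f)) (sum-tabulate f)
  where
  sum-tabulate : ∀ {k} (f : Fin k → ℕ) → ListAction.sum (List.tabulate f) ≡ sum f
  sum-tabulate {zero} f = refl
  sum-tabulate {suc k} f = cong (f zero +_) (sum-tabulate (f ∘ suc))

lookup≡⟦∈?⟧ : ∀ {k} (S : Subset k) x → (if lookup S x then 1 else 0) ≡ ⟦ x ∈? S ⟧
lookup≡⟦∈?⟧ S x with x ∈? S
... | yes x∈S rewrite []=⇒lookup x∈S = refl
... | no x∉S with lookup S x in eq
...   | true = contradiction (lookup⇒[]= x S eq) x∉S
...   | false = refl

∣∣≡∑ : ∀ {k} (S : Subset k) → ∣ S ∣ ≡ sum (λ x → ⟦ x ∈? S ⟧)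
∣∣≡∑ S = trans (go S) (sum-cong-≗ (lookup≡⟦∈?⟧ S))
  where
  go : ∀ {k} (S : Subset k) → ∣ S ∣ ≡ sum (λ x → if lookup S x then 1 else 0)
  go [] = refl
  go (true ∷ S) = cong suc (go S)
  go (false ∷ S) = go S

⟨_⟩ : ∀ {k} {P : Fin k → Set} → Decidable P → Subset k
⟨ P? ⟩ = tabulate (does ∘ P?)

∈⟨⟩⁺ : ∀ {k} {P : Fin k → Set} (P? : Decidable P) {x} → P x → x ∈ ⟨ P? ⟩
∈⟨⟩⁺ P? {x} p = lookup⇒[]= x _ (trans (lookup∘tabulate _ x) (dec-true (P? x) p))

∈⟨⟩⁻ : ∀ {k} {P : Fin k → Set} (P? : Decidable P) {x} → x ∈ ⟨ P? ⟩ → P x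
∈⟨⟩⁻ P? {x} x∈ with P? x in eq
... | yes p = p
... | no ¬p = contradiction (trans (sym (dec-false (P? x) ¬p)) (trans (sym (lookup∘tabulate (does ∘ P?) x)) ([]=⇒lookup x∈))) λ ()

x∈p─q⇒x∉q : ∀ {k} (p q : Subset k) {x} → x ∈ p ─ q → x ∉ q
x∈p─q⇒x∉q (true ∷ p) (false ∷ q) here ()
x∈p─q⇒x∉q (_ ∷ p) (_ ∷ q) (there x∈) (there x∈q) = x∈p─q⇒x∉q p q x∈ x∈q

x∈p-y⇒x∈p : ∀ {k} {p : Subset k} {x} y → x ∈ p - y → x ∈ p
x∈p-y⇒x∈p {p = p} y = p─q⊆p p ⁅ y ⁆

x∈p-y⇒x≢y : ∀ {k} {p : Subset k} {x} y → x ∈ p - y → x ≢ y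
x∈p-y⇒x≢y {p = p} y x∈ refl = x∈p─q⇒x∉q p ⁅ y ⁆ x∈ (x∈⁅x⁆ y)

-- Walks, trails and connectivity.

module Walks (G : Multigraph) where

  private
    V = Fin (n G)
    E = Fin (m G)
    variable
      u v w : V
      S S′ : EdgeSet G
      es : List E

  src tgt : E → V
  src = proj₁ ∘ ends G
  tgt = proj₂ ∘ ends G

  infix 4 _~[_]_
  _~[_]_ : V → EdgeSet G → V → Set
  u ~[ S ] v = ∃ λ es → Walk G S u v es

  ~-refl : v ~[ S ] v
  ~-refl = [] , nil

  ~-edge : ∀ {e} → e ∈ S → src e ~[ S ] tgt e
  ~-edge e∈S = _ , fwd _ e∈S nil

  ~-trans : u ~[ S ] v → v ~[ S ] w → u ~[ S ] w
  ~-trans (_ , p) q = go p q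
    where
    go : Walk G S u v es → v ~[ S ] w → u ~[ S ] w
    go nil q = q
    go (fwd e e∈S p) q = _ , fwd e e∈S (proj₂ (go p q))
    go (bwd e e∈S p) q = _ , bwd e e∈S (proj₂ (go p q))

  ~-sym : u ~[ S ] v → v ~[ S ] u
  ~-sym (_ , p) = go p
    where
    go : Walk G S u v es → v ~[ S ] u
    go nil = ~-refl
    go (fwd e e∈S p) = ~-trans (go p) (_ , bwd e e∈S nil)
    go (bwd e e∈S p) = ~-trans (go p) (_ , fwd e e∈S nil)

  -- Both directions are demanded of every edge because `R` is not assumed symmetric.
  ~-elim : (R : V → V → Set) → (∀ {v} → R v v) → (∀ {u v w} → R u v → R v w → R u w) →
           (∀ e → e ∈ S → R (src e) (tgt e) × R (tgt e) (src e)) → u ~[ S ] v → R u v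
  ~-elim {S = S} R r t s (_ , p) = go p
    where
    go : ∀ {u v es} → Walk G S u v es → R u v
    go nil = r
    go (fwd e e∈S p) = t (proj₁ (s e e∈S)) (go p)
    go (bwd e e∈S p) = t (proj₂ (s e e∈S)) (go p)

  ~-replace : (∀ e → e ∈ S → src e ~[ S′ ] tgt e) → u ~[ S ] v → u ~[ S′ ] v
  ~-replace {S′ = S′} s = ~-elim (_~[ S′ ]_) ~-refl ~-trans (λ e e∈S → s e e∈S , ~-sym (s e e∈S))

  ~-mono : S ⊆ S′ → u ~[ S ] v → u ~[ S′ ] v
  ~-mono S⊆S′ = ~-replace λ e e∈S → ~-edge (S⊆S′ e∈S)

  Connected-mono : S ⊆ S′ → Connected G S → Connected G S′
  Connected-mono S⊆S′ conn u v = ~-mono S⊆S′ (conn u v)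

  walk-edges : Walk G S u v es → ∀ {e} → e ∈ₗ es → e ∈ S
  walk-edges (fwd e e∈S p) (here refl) = e∈S
  walk-edges (fwd e e∈S p) (there i) = walk-edges p i
  walk-edges (bwd e e∈S p) (here refl) = e∈S
  walk-edges (bwd e e∈S p) (there i) = walk-edges p i

  restrict : Walk G S u v es → (∀ {e} → e ∈ₗ es → e ∈ S′) → Walk G S′ u v es
  restrict nil f = nil
  restrict (fwd e _ p) f = fwd e (f (here refl)) (restrict p (f ∘ there))
  restrict (bwd e _ p) f = bwd e (f (here refl)) (restrict p (f ∘ there))

  Trail : EdgeSet G → V → V → Set
  Trail S u v = ∃ λ es → Walk G S u v es × Unique es

  open import Data.List.Membership.DecPropositional (_≟_ {m G}) using () renaming (_∈?_ to _∈ₗ?_)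

  -- The suffix that begins with `e` starts at one end of `e`, and the suffix just after `e` starts
  -- at the other end.
  trail-from-edge : Walk G S u v es → Unique es → ∀ {e} → e ∈ₗ es → Trail S (src e) v × Trail S (tgt e) v
  trail-from-edge p@(fwd e _ q) U@(_ ∷ U′) (here refl) = (_ , p , U) , (_ , q , U′)
  trail-from-edge p@(bwd e _ q) U@(_ ∷ U′) (here refl) = (_ , q , U′) , (_ , p , U)
  trail-from-edge (fwd e _ q) (_ ∷ U) (there i) = trail-from-edge q U i
  trail-from-edge (bwd e _ q) (_ ∷ U) (there i) = trail-from-edge q U i

  -- When the prepended edge already occurs on the trail, everything before that occurrence is cut
  -- off. The remaining suffix can be started at whichever end of the edge is required.
  walk⇒trail : Walk G S u v es → Trail S u v
  walk⇒trail nil = [] , nil , []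
  walk⇒trail (fwd e e∈S p) with walk⇒trail p
  ... | es , q , U with e ∈ₗ? es
  ...   | yes e∈es = proj₁ (trail-from-edge q U e∈es)
  ...   | no e∉es = e ∷ es , fwd e e∈S q , ¬Any⇒All¬ es e∉es ∷ U
  walk⇒trail (bwd e e∈S p) with walk⇒trail p
  ... | es , q , U with e ∈ₗ? es
  ...   | yes e∈es = proj₂ (trail-from-edge q U e∈es)
  ...   | no e∉es = e ∷ es , bwd e e∈S q , ¬Any⇒All¬ es e∉es ∷ U

  -- The alternatives are the two directions in which a trail from `u` to `v` can traverse `f`.
  Detour : EdgeSet G → V → V → E → Set
  Detour S u v f = u ~[ S - f ] src f × tgt f ~[ S - f ] v ⊎ u ~[ S - f ] tgt f × src f ~[ S - f ] v

  -- Edges of a trail are distinct, so `f` occurs once and the pieces before and after it avoid `f`.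
  split-trail : Walk G S u v es → Unique es → ∀ {f} → f ∈ₗ es → Detour S u v f
  split-trail {S = S} (fwd e e∈S q) (e# ∷ _) (here refl) =
    inj₁ (~-refl , _ , restrict q λ i → x∈p∧x≢y⇒x∈p-y (walk-edges q i) (≢-sym (All.lookup e# i)))
  split-trail (bwd e e∈S q) (e# ∷ _) (here refl) =
    inj₂ (~-refl , _ , restrict q λ i → x∈p∧x≢y⇒x∈p-y (walk-edges q i) (≢-sym (All.lookup e# i)))
  split-trail (fwd e e∈S q) (e# ∷ U) (there i) with x∈p∧x≢y⇒x∈p-y e∈S (All.lookup e# i) | split-trail q U i
  ... | e∈ | inj₁ (a , b) = inj₁ (~-trans (~-edge e∈) a , b)
  ... | e∈ | inj₂ (a , b) = inj₂ (~-trans (~-edge e∈) a , b)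
  split-trail (bwd e e∈S q) (e# ∷ U) (there i) with x∈p∧x≢y⇒x∈p-y e∈S (All.lookup e# i) | split-trail q U i
  ... | e∈ | inj₁ (a , b) = inj₁ (~-trans (~-sym (~-edge e∈)) a , b)
  ... | e∈ | inj₂ (a , b) = inj₂ (~-trans (~-sym (~-edge e∈)) a , b)

  -- Union-find: label es v is the representative of the component of v in the graph with edges es.
  merge : (V → V) → E → V → V
  merge c e v with c v ≟ c (tgt e)
  ... | yes _ = c (src e)
  ... | no _ = c v

  label : List E → V → V
  label [] = id
  label (e ∷ es) = merge (label es) e

  merge-cong : ∀ c e {u v} → c u ≡ c v → merge c e u ≡ merge c e v
  merge-cong c e {u} {v} eq with c u ≟ c (tgt e) | c v ≟ c (tgt e)
  ... | yes _ | yes _ = refl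
  ... | no _ | no _ = eq
  ... | yes p | no q = contradiction (trans (sym eq) p) q
  ... | no p | yes q = contradiction (trans eq q) p

  merge-edge : ∀ c e → merge c e (src e) ≡ merge c e (tgt e)
  merge-edge c e with c (src e) ≟ c (tgt e) | c (tgt e) ≟ c (tgt e)
  ... | yes _ | yes _ = refl
  ... | no _ | yes _ = refl
  ... | _ | no q = contradiction refl q

  label-idem : ∀ es v → label es (label es v) ≡ label es v
  label-idem [] v = refl
  label-idem (e ∷ es) v with c v ≟ c (tgt e)
    where c = label es
  label-idem (e ∷ es) v | yes _ with c (c (src e)) ≟ c (tgt e)
    where c = label es
  ... | yes _ = refl
  ... | no _ = label-idem es (src e)
  label-idem (e ∷ es) v | no q with c (c v) ≟ c (tgt e)
    where c = label es
  ... | yes p = contradiction (trans (sym (label-idem es v)) p) q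
  ... | no _ = label-idem es v

  label-edge : ∀ {es e} → e ∈ₗ es → label es (src e) ≡ label es (tgt e)
  label-edge {e ∷ es} (here refl) = merge-edge (label es) e
  label-edge {e ∷ es} (there i) = merge-cong (label es) e (label-edge i)

  ~⇒label : (∀ {e} → e ∈ S → e ∈ₗ es) → u ~[ S ] v → label es u ≡ label es v
  ~⇒label {es = es} f = ~-elim (λ u v → label es u ≡ label es v) refl trans
    λ e e∈S → label-edge (f e∈S) , sym (label-edge (f e∈S))

  ~-label : (∀ {e} → e ∈ₗ es → e ∈ S) → ∀ v → v ~[ S ] label es v
  ~-label {[]} f v = ~-refl
  ~-label {e ∷ es} f v with label es v ≟ label es (tgt e)
  ... | no _ = ~-label (f ∘ there) v
  ... | yes p = ~-trans (subst (v ~[ _ ]_) p (~-label (f ∘ there) v))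
                 (~-trans (~-sym (~-label (f ∘ there) (tgt e)))
                   (~-trans (~-sym (~-edge (f (here refl)))) (~-label (f ∘ there) (src e))))

  label⇒~ : (∀ {e} → e ∈ₗ es → e ∈ S) → label es u ≡ label es v → u ~[ S ] v
  label⇒~ {u = u} {v} f eq = ~-trans (~-label f u) (subst (_~[ _ ] v) (sym eq) (~-sym (~-label f v)))

  -- Deciding connectivity, counting components and growing spanning trees.

  elems : EdgeSet G → List E
  elems S = filter (_∈? S) (allFin (m G))

  ∈-elems⁺ : ∀ {e} → e ∈ S → e ∈ₗ elems S
  ∈-elems⁺ {S} {e} = ∈-filter⁺ (_∈? S) (∈-allFin e)

  ∈-elems⁻ : ∀ {e} → e ∈ₗ elems S → e ∈ S
  ∈-elems⁻ {S} i = proj₂ (∈-filter⁻ (_∈? S) {xs = allFin (m G)} i)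

  elems-unique : ∀ S → Unique (elems S)
  elems-unique S = filter⁺ (_∈? S) (allFin⁺ (m G))

  _~?_ : ∀ u v → Dec (u ~[ S ] v)
  _~?_ {S} u v = map′ (label⇒~ ∈-elems⁻) (~⇒label ∈-elems⁺) (label (elems S) u ≟ label (elems S) v)

  connected? : ∀ S → Dec (Connected G S)
  connected? S = all? λ u → all? λ v → u ~? v

  -- The number of components: `label es` is idempotent, so each component has exactly one fixed
  -- point.
  roots : List E → ℕ
  roots es = sum λ k → ⟦ label es k ≟ k ⟧

  ∑⟦∈⟧≡length : Unique es → sum (λ e → ⟦ e ∈ₗ? es ⟧) ≡ length es
  ∑⟦∈⟧≡length {[]} _ = ∑-zero {m G} _ (λ e → refl)
  ∑⟦∈⟧≡length {e ∷ es} (e# ∷ U) = begin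
    sum (λ x → ⟦ x ∈ₗ? (e ∷ es) ⟧)                      ≡⟨ sum-cong-≗ pointwise ⟩
    sum (λ x → ⟦ e ≟ x ⟧ + ⟦ x ∈ₗ? es ⟧)                ≡⟨ ∑-distrib-+ {m G} _ _ ⟩
    sum (λ x → ⟦ e ≟ x ⟧) + sum (λ x → ⟦ x ∈ₗ? es ⟧)    ≡⟨ cong₂ _+_ (∑-single e) (∑⟦∈⟧≡length U) ⟩
    suc (length es)                                     ∎
    where
    open ≡-Reasoning
    pointwise : ∀ x → ⟦ x ∈ₗ? (e ∷ es) ⟧ ≡ ⟦ e ≟ x ⟧ + ⟦ x ∈ₗ? es ⟧
    pointwise x with e ≟ x
    ... | yes refl = trans (⟦⟧-yes (x ∈ₗ? (x ∷ es)) (here refl))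
                       (cong suc (sym (⟦⟧-no (x ∈ₗ? es) λ i → All.lookup e# i refl)))
    ... | no e≢x = ⟦⟧-cong (x ∈ₗ? (e ∷ es)) (x ∈ₗ? es)
                       (λ { (here eq) → contradiction (sym eq) e≢x ; (there i) → i }) there

  length-elems : ∀ S → length (elems S) ≡ ∣ S ∣
  length-elems S = begin
    length (elems S)                     ≡⟨ ∑⟦∈⟧≡length (elems-unique S) ⟨
    sum (λ e → ⟦ e ∈ₗ? elems S ⟧)        ≡⟨ sum-cong-≗ (λ e → ⟦⟧-cong (e ∈ₗ? elems S) (e ∈? S) ∈-elems⁻ ∈-elems⁺) ⟩
    sum (λ e → ⟦ e ∈? S ⟧)               ≡⟨ ∣∣≡∑ S ⟨
    ∣ S ∣                                ∎
    where open ≡-Reasoning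

  -- A new edge `e` can destroy only one root, namely the representative of the component of
  -- `tgt e`, which is absorbed into that of `src e`.
  n≤roots+length : ∀ es → n G ≤ roots es + length es
  n≤roots+length [] = ≤-reflexive (begin
    n G                         ≡⟨ *-identityʳ (n G) ⟨
    n G * 1                     ≡⟨ ∑-const (n G) 1 ⟨
    sum {n G} (λ _ → 1)         ≡⟨ sum-cong-≗ {n G} (λ k → sym (⟦⟧-yes (k ≟ k) refl)) ⟩
    roots []                    ≡⟨ +-identityʳ _ ⟨
    roots [] + 0                ∎)
    where open ≡-Reasoning
  n≤roots+length (e ∷ es) = begin
    n G                                       ≤⟨ n≤roots+length es ⟩
    roots es + length es                      ≤⟨ +-monoˡ-≤ _ (∑-mono pointwise) ⟩
    sum (λ k → ⟦ label (e ∷ es) k ≟ k ⟧ + ⟦ label es (tgt e) ≟ k ⟧) + length es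
                                              ≡⟨ cong (_+ length es) (∑-distrib-+ {n G} _ _) ⟩
    roots (e ∷ es) + sum (λ k → ⟦ label es (tgt e) ≟ k ⟧) + length es
                                              ≡⟨ cong (λ x → roots (e ∷ es) + x + length es) (∑-single (label es (tgt e))) ⟩
    roots (e ∷ es) + 1 + length es            ≡⟨ +-assoc (roots (e ∷ es)) 1 _ ⟩
    roots (e ∷ es) + suc (length es)          ∎
    where
    open ≤-Reasoning
    pointwise : ∀ k → ⟦ label es k ≟ k ⟧ ≤ ⟦ label (e ∷ es) k ≟ k ⟧ + ⟦ label es (tgt e) ≟ k ⟧
    pointwise k with label es k ≟ label es (tgt e)
    ... | no _ = m≤m+n _ _
    ... | yes p = ≤-trans (⟦⟧-mono (label es k ≟ k) (label es (tgt e) ≟ k) (trans (sym p)))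
                          (m≤n+m _ ⟦ label es (src e) ≟ k ⟧)

  -- A certificate of acyclicity by construction: every edge joins two different components of the
  -- edges behind it in the list.
  data Independent : List E → Set where
    []  : Independent []
    _∷_ : ∀ {e es} → label es (src e) ≢ label es (tgt e) → Independent es → Independent (e ∷ es)

  independent⇒unique : Independent es → Unique es
  independent⇒unique [] = []
  independent⇒unique (e# ∷ I) = All.tabulate (λ { i refl → e# (label-edge i) }) ∷ independent⇒unique I

  -- Here the root of `tgt e` really is lost with each edge, since the two merged components were
  -- different.
  roots+length≤n : Independent es → roots es + length es ≤ n G
  roots+length≤n [] = begin
    roots [] + 0               ≡⟨ +-identityʳ _ ⟩
    roots []                   ≤⟨ ∑-mono {n G} (λ k → ⟦⟧-mono (k ≟ k) (yes refl) id) ⟩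
    sum {n G} (λ _ → 1)        ≡⟨ ∑-const (n G) 1 ⟩
    n G * 1                    ≡⟨ *-identityʳ (n G) ⟩
    n G                        ∎
    where open ≤-Reasoning
  roots+length≤n {e ∷ es} (e# ∷ I) = begin
    roots (e ∷ es) + suc (length es)          ≡⟨ +-assoc (roots (e ∷ es)) 1 _ ⟨
    roots (e ∷ es) + 1 + length es
      ≡⟨ cong (λ x → roots (e ∷ es) + x + length es) (∑-single (label es (tgt e))) ⟨
    roots (e ∷ es) + sum (λ k → ⟦ label es (tgt e) ≟ k ⟧) + length es
                                              ≡⟨ cong (_+ length es) (∑-distrib-+ {n G} _ _) ⟨
    sum (λ k → ⟦ label (e ∷ es) k ≟ k ⟧ + ⟦ label es (tgt e) ≟ k ⟧) + length es
                                              ≤⟨ +-monoˡ-≤ _ (∑-mono pointwise) ⟩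
    roots es + length es                      ≤⟨ roots+length≤n I ⟩
    n G                                       ∎
    where
    open ≤-Reasoning
    pointwise : ∀ k → ⟦ label (e ∷ es) k ≟ k ⟧ + ⟦ label es (tgt e) ≟ k ⟧ ≤ ⟦ label es k ≟ k ⟧
    pointwise k with label es k ≟ label es (tgt e)
    ... | yes p = ≤-trans (≤-reflexive (cong (_+ ⟦ label es (tgt e) ≟ k ⟧) (⟦⟧-no (label es (src e) ≟ k)
                    -- If the root `k` were also the label of `src e`, idempotence would give both
                    -- ends of `e` the same label.
                    λ { refl → e# (trans (sym (label-idem es (src e))) p) })))
                    (⟦⟧-mono (label es (tgt e) ≟ k) (label es k ≟ k) (trans p))
    ... | no q = ≤-reflexive (trans (cong (⟦ label es k ≟ k ⟧ +_) (⟦⟧-no (label es (tgt e) ≟ k)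
                    λ { refl → q (label-idem es (tgt e)) })) (+-identityʳ _))

  -- If the ends of `e` had equal labels, a trail through the later edges would join them.
  -- Distinctness keeps `e` off that trail, so `e` would close it to a cycle.
  forest⇒independent : ∀ {F} → Forest G F → Unique es → (∀ {e} → e ∈ₗ es → e ∈ F) → Independent es
  forest⇒independent {[]} acyc [] f = []
  forest⇒independent {e ∷ es} {F} acyc (e# ∷ U) f = e-new ∷ forest⇒independent acyc U (f ∘ there)
    where
    e-new : label es (src e) ≢ label es (tgt e)
    e-new eq with walk⇒trail (proj₂ (label⇒~ {S = F - e} (λ i → x∈p∧x≢y⇒x∈p-y (f (there i)) (≢-sym (All.lookup e# i))) (sym eq)))
    ... | ps , p , Up = acyc (src e , e , ps , fwd e (f (here refl)) (restrict p (x∈p-y⇒x∈p e ∘ walk-edges p)) ,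
                              All.tabulate (λ i → ≢-sym (x∈p-y⇒x≢y {p = F} e (walk-edges p i))) ∷ Up)

  record Extension (es xs : List E) : Set where
    field
      tree        : List E
      independent : Independent tree
      ⊇base       : ∀ {e} → e ∈ₗ es → e ∈ₗ tree
      ⊆both       : ∀ {e} → e ∈ₗ tree → e ∈ₗ es ⊎ e ∈ₗ xs
      spanning    : ∀ {e} → e ∈ₗ xs → label tree (src e) ≡ label tree (tgt e)

  -- Kruskal's greedy rule: an edge is taken exactly when its ends have different labels. Edges
  -- already spanned stay spanned, because merging only identifies labels.
  extend : ∀ {es} → Independent es → ∀ xs → Extension es xs
  extend I [] = record { tree = _ ; independent = I ; ⊇base = id ; ⊆both = inj₁ ; spanning = λ () }
  extend I (x ∷ xs) = add (extend I xs)
    where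
    add : Extension _ xs → Extension _ (x ∷ xs)
    add X with label (Extension.tree X) (src x) ≟ label (Extension.tree X) (tgt x)
    ... | yes p = record
      { tree = tree ; independent = independent ; ⊇base = ⊇base
      ; ⊆both = λ i → map₂ there (⊆both i)
      ; spanning = λ { (here refl) → p ; (there i) → spanning i } }
      where open Extension X
    ... | no q = record
      { tree = x ∷ tree ; independent = q ∷ independent ; ⊇base = there ∘ ⊇base
      ; ⊆both = λ { (here refl) → inj₂ (here refl) ; (there i) → map₂ there (⊆both i) }
      ; spanning = λ { (here refl) → merge-edge (label tree) x ; (there i) → merge-cong (label tree) x (spanning i) } }
      where open Extension X

-- Products of indicators and degree sums.

⟦⟧-× : (P? : Dec P) (Q? : Dec Q) → ⟦ P? ×-dec Q? ⟧ ≡ ⟦ P? ⟧ * ⟦ Q? ⟧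
⟦⟧-× (yes _) (yes _) = refl
⟦⟧-× (yes _) (no _) = refl
⟦⟧-× (no _) _ = refl

⟦⟧≤1 : (P? : Dec P) → ⟦ P? ⟧ ≤ 1
⟦⟧≤1 (yes _) = s≤s z≤n
⟦⟧≤1 (no _) = z≤n

⟦⟧*≤ : (P? : Dec P) → ∀ x → ⟦ P? ⟧ * x ≤ x
⟦⟧*≤ P? x = ≤-trans (*-monoˡ-≤ x (⟦⟧≤1 P?)) (≤-reflexive (*-identityˡ x))

⟦⟧*-mono : (P? : Dec P) → ∀ {x y} → (P → x ≤ y) → ⟦ P? ⟧ * x ≤ ⟦ P? ⟧ * y
⟦⟧*-mono (yes p) x≤y = *-monoʳ-≤ 1 (x≤y p)
⟦⟧*-mono (no _) x≤y = z≤n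

module Degrees (G : Multigraph) where

  open Walks G

  private
    V = Fin (n G)
    E = Fin (m G)

  inc? : ∀ e v → Dec (src e ≡ v ⊎ tgt e ≡ v)
  inc? e v = (src e ≟ v) ⊎-dec (tgt e ≟ v)

  incident⇒ : ∀ e v → incident G e v ≡ true → src e ≡ v ⊎ tgt e ≡ v
  incident⇒ e v eq with src e ≟ v | tgt e ≟ v
  ... | yes p | _ = inj₁ p
  ... | no _ | yes q = inj₂ q

  ⇒incident : ∀ e v → src e ≡ v ⊎ tgt e ≡ v → incident G e v ≡ true
  ⇒incident e v i with src e ≟ v | tgt e ≟ v
  ... | yes p | _ = refl
  ... | no _ | yes q = refl
  ⇒incident e v (inj₁ p) | no ¬p | no _ = contradiction p ¬p
  ⇒incident e v (inj₂ q) | no _ | no ¬q = contradiction q ¬q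

  ∈δ⁻ : ∀ {S e v} → e ∈ δ G S v → e ∈ S × (src e ≡ v ⊎ tgt e ≡ v)
  ∈δ⁻ {S} {e} {v} e∈δ with lookup S e in eq | incident G e v in eq′ | trans (sym (lookup∘tabulate _ e)) ([]=⇒lookup e∈δ)
  ... | true | true | _ = lookup⇒[]= e S eq , incident⇒ e v eq′

  ∈δ⁺ : ∀ {S e v} → e ∈ S → (src e ≡ v ⊎ tgt e ≡ v) → e ∈ δ G S v
  ∈δ⁺ {S} {e} {v} e∈S i = lookup⇒[]= e _ (trans (lookup∘tabulate _ e) (cong₂ _∧_ ([]=⇒lookup e∈S) (⇒incident e v i)))

  deg≡∑ : ∀ S v → deg G S v ≡ sum (λ e → ⟦ e ∈? S ⟧ * ⟦ inc? e v ⟧)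
  deg≡∑ S v = trans (∣∣≡∑ (δ G S v)) (sum-cong-≗ {m G} λ e →
    trans (⟦⟧-cong (e ∈? δ G S v) ((e ∈? S) ×-dec inc? e v) ∈δ⁻ (λ (a , b) → ∈δ⁺ a b)) (⟦⟧-× (e ∈? S) (inc? e v)))

  -- Double counting of incidences. With the indicator of a component as weight, it sums degrees
  -- over that component only.
  handshake : ∀ (w : V → ℕ) S →
    sum (λ v → w v * deg G S v) ≡ sum (λ e → ⟦ e ∈? S ⟧ * sum (λ v → w v * ⟦ inc? e v ⟧))
  handshake w S = begin
    sum (λ v → w v * deg G S v)
      ≡⟨ sum-cong-≗ {n G} (λ v → trans (cong (w v *_) (deg≡∑ S v)) (*-distribˡ-sum {m G} (w v) _)) ⟩
    sum (λ v → sum (λ e → w v * (⟦ e ∈? S ⟧ * ⟦ inc? e v ⟧)))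
      ≡⟨ ∑-comm {n G} {m G} _ ⟩
    sum (λ e → sum (λ v → w v * (⟦ e ∈? S ⟧ * ⟦ inc? e v ⟧)))
      ≡⟨ sum-cong-≗ {m G} (λ e → trans (sum-cong-≗ {n G} λ v → swap (w v) ⟦ e ∈? S ⟧ ⟦ inc? e v ⟧)
                                       (sym (*-distribˡ-sum {n G} ⟦ e ∈? S ⟧ _))) ⟩
    sum (λ e → ⟦ e ∈? S ⟧ * sum (λ v → w v * ⟦ inc? e v ⟧)) ∎
    where
    open ≡-Reasoning
    swap : ∀ a b c → a * (b * c) ≡ b * (a * c)
    swap = solve-∀

  -- Only an inequality, because a loop is one incident edge but appears twice on the right.
  ∑inc≤ : ∀ (w : V → ℕ) e → sum (λ v → w v * ⟦ inc? e v ⟧) ≤ w (src e) + w (tgt e)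
  ∑inc≤ w e = begin
    sum (λ v → w v * ⟦ inc? e v ⟧)
      ≤⟨ ∑-mono {n G} pointwise ⟩
    sum (λ v → w v * ⟦ src e ≟ v ⟧ + w v * ⟦ tgt e ≟ v ⟧)
      ≡⟨ ∑-distrib-+ {n G} _ _ ⟩
    sum (λ v → w v * ⟦ src e ≟ v ⟧) + sum (λ v → w v * ⟦ tgt e ≟ v ⟧)
      ≡⟨ cong₂ _+_ (∑-point w (src e)) (∑-point w (tgt e)) ⟩
    w (src e) + w (tgt e) ∎
    where
    open ≤-Reasoning
    pointwise : ∀ v → w v * ⟦ inc? e v ⟧ ≤ w v * ⟦ src e ≟ v ⟧ + w v * ⟦ tgt e ≟ v ⟧
    pointwise v with src e ≟ v | tgt e ≟ v
    ... | yes _ | _ = m≤m+n _ _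
    ... | no _ | yes _ = m≤n+m _ _
    ... | no _ | no _ = m≤m+n _ _

  ≤∑inc : ∀ (w : V → ℕ) e {v} → src e ≡ v ⊎ tgt e ≡ v → w v ≤ sum (λ v → w v * ⟦ inc? e v ⟧)
  ≤∑inc w e {v} i = begin
    w v                              ≡⟨ *-identityʳ _ ⟨
    w v * 1                          ≡⟨ cong (w v *_) (⟦⟧-yes (inc? e v) i) ⟨
    w v * ⟦ inc? e v ⟧               ≤⟨ term≤∑ (λ v → w v * ⟦ inc? e v ⟧) v ⟩
    sum (λ v → w v * ⟦ inc? e v ⟧)   ∎
    where open ≤-Reasoning

  ∑deg≤ : ∀ S → sum (deg G S) ≤ 2 * ∣ S ∣
  ∑deg≤ S = begin
    sum (deg G S)                 ≡⟨ sum-cong-≗ {n G} (λ v → sym (*-identityˡ (deg G S v))) ⟩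
    sum (λ v → 1 * deg G S v)     ≡⟨ handshake (λ _ → 1) S ⟩
    sum (λ e → ⟦ e ∈? S ⟧ * sum (λ v → 1 * ⟦ inc? e v ⟧))
      ≤⟨ ∑-mono {m G} (λ e → *-monoʳ-≤ ⟦ e ∈? S ⟧ (∑inc≤ (λ _ → 1) e)) ⟩
    sum (λ e → ⟦ e ∈? S ⟧ * 2)    ≡⟨ *-distribʳ-sum {m G} 2 _ ⟨
    sum (λ e → ⟦ e ∈? S ⟧) * 2    ≡⟨ *-comm (sum (λ e → ⟦ e ∈? S ⟧)) 2 ⟩
    2 * sum (λ e → ⟦ e ∈? S ⟧)    ≡⟨ cong (2 *_) (∣∣≡∑ S) ⟨
    2 * ∣ S ∣                     ∎
    where open ≤-Reasoning

  deg-≤ : ∀ {S S₁ S₂} → (∀ {e} → e ∈ S → e ∈ S₁ ⊎ e ∈ S₂) → ∀ v → deg G S v ≤ deg G S₁ v + deg G S₂ v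
  deg-≤ {S} {S₁} {S₂} S⊆ v = begin
    deg G S v                                        ≡⟨ deg≡∑ S v ⟩
    sum (λ e → ⟦ e ∈? S ⟧ * ⟦ inc? e v ⟧)            ≤⟨ ∑-mono {m G} pointwise ⟩
    sum (λ e → ⟦ e ∈? S₁ ⟧ * ⟦ inc? e v ⟧ + ⟦ e ∈? S₂ ⟧ * ⟦ inc? e v ⟧)
                                                     ≡⟨ ∑-distrib-+ {m G} _ _ ⟩
    sum (λ e → ⟦ e ∈? S₁ ⟧ * ⟦ inc? e v ⟧) + sum (λ e → ⟦ e ∈? S₂ ⟧ * ⟦ inc? e v ⟧)
                                                     ≡⟨ cong₂ _+_ (deg≡∑ S₁ v) (deg≡∑ S₂ v) ⟨
    deg G S₁ v + deg G S₂ v                          ∎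
    where
    open ≤-Reasoning
    pointwise : ∀ e → ⟦ e ∈? S ⟧ * ⟦ inc? e v ⟧ ≤ ⟦ e ∈? S₁ ⟧ * ⟦ inc? e v ⟧ + ⟦ e ∈? S₂ ⟧ * ⟦ inc? e v ⟧
    pointwise e with e ∈? S
    ... | no _ = z≤n
    ... | yes e∈S with S⊆ e∈S
    ...   | inj₁ e∈S₁ = ≤-trans (≤-reflexive (cong (_* ⟦ inc? e v ⟧) (sym (⟦⟧-yes (e ∈? S₁) e∈S₁)))) (m≤m+n _ _)
    ...   | inj₂ e∈S₂ = ≤-trans (≤-reflexive (cong (_* ⟦ inc? e v ⟧) (sym (⟦⟧-yes (e ∈? S₂) e∈S₂)))) (m≤n+m _ _)

  -- A forest has at most |K| - 1 edges inside a nonempty node set `K`. In the graph of these inner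
  -- edges every node outside `K` is a root, and `K` contains at least one further root.
  forest-induced : ∀ {F} → Forest G F → {K : V → Set} (K? : Decidable K) → ∀ {k} → K k →
    suc (sum (λ f → ⟦ f ∈? F ⟧ * (⟦ K? (src f) ⟧ * ⟦ K? (tgt f) ⟧))) ≤ sum (λ v → ⟦ K? v ⟧)
  forest-induced {F} acyc {K} K? {k} Kk = +-cancelˡ-≤ (roots es) _ _ (begin
    roots es + suc (sum (λ f → ⟦ f ∈? F ⟧ * (⟦ K? (src f) ⟧ * ⟦ K? (tgt f) ⟧)))
      ≡⟨ cong (λ x → roots es + suc x) (trans (sum-cong-≗ {m G} in-S) (sym (∣∣≡∑ S))) ⟩
    roots es + suc ∣ S ∣                   ≡⟨ cong (λ x → roots es + suc x) (length-elems S) ⟨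
    roots es + suc (length es)             ≡⟨ +-suc (roots es) _ ⟩
    suc (roots es + length es)             ≤⟨ s≤s (roots+length≤n indep) ⟩
    suc (n G)                                ≡⟨ +-comm 1 (n G) ⟩
    n G + 1                                  ≡⟨ cong₂ _+_ (trans (∑-const (n G) 1) (*-identityʳ (n G))) (∑-single r) ⟨
    sum {n G} (λ _ → 1) + sum (λ v → ⟦ r ≟ v ⟧)  ≡⟨ ∑-distrib-+ {n G} _ _ ⟨
    sum (λ v → 1 + ⟦ r ≟ v ⟧)                ≤⟨ ∑-mono {n G} pointwise ⟩
    sum (λ v → ⟦ label es v ≟ v ⟧ + ⟦ K? v ⟧)  ≡⟨ ∑-distrib-+ {n G} _ _ ⟩
    roots es + sum (λ v → ⟦ K? v ⟧)        ∎)
    where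
    open ≤-Reasoning
    inside? : Decidable (λ f → f ∈ F × K (src f) × K (tgt f))
    inside? f = (f ∈? F) ×-dec K? (src f) ×-dec K? (tgt f)
    S = ⟨ inside? ⟩
    es = elems S
    r = label es k

    indep : Independent es
    indep = forest⇒independent acyc (elems-unique S) (proj₁ ∘ ∈⟨⟩⁻ inside? ∘ ∈-elems⁻)

    in-S : ∀ f → ⟦ f ∈? F ⟧ * (⟦ K? (src f) ⟧ * ⟦ K? (tgt f) ⟧) ≡ ⟦ f ∈? S ⟧
    in-S f = sym (trans (⟦⟧-cong (f ∈? S) (inside? f) (∈⟨⟩⁻ inside?) (∈⟨⟩⁺ inside?))
                   (trans (⟦⟧-× (f ∈? F) _) (cong (⟦ f ∈? F ⟧ *_) (⟦⟧-× (K? (src f)) (K? (tgt f))))))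

    -- A walk along inner edges either is trivial or has both ends in `K`.
    label-K : ∀ v → v ≡ label es v ⊎ K v × K (label es v)
    label-K v = ~-elim (λ u v → u ≡ v ⊎ K u × K v) (inj₁ refl)
      (λ { (inj₁ refl) q → q ; (inj₂ p) (inj₁ refl) → inj₂ p ; (inj₂ (p , _)) (inj₂ (_ , q)) → inj₂ (p , q) })
      (λ e e∈S → let (_ , s , t) = ∈⟨⟩⁻ inside? e∈S in inj₂ (s , t) , inj₂ (t , s))
      (~-label (∈-elems⁻) v)

    Kr : K r
    Kr with label-K k
    ... | inj₁ k≡r = subst K k≡r Kk
    ... | inj₂ (_ , q) = q

    -- Every node is a root or lies in `K`, and `r` does both. This second contribution of `r`
    -- yields the `suc` in the claim.
    pointwise : ∀ v → 1 + ⟦ r ≟ v ⟧ ≤ ⟦ label es v ≟ v ⟧ + ⟦ K? v ⟧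
    pointwise v with r ≟ v
    ... | yes refl = ≤-reflexive (sym (cong₂ _+_ (⟦⟧-yes (label es r ≟ r) (label-idem es k)) (⟦⟧-yes (K? r) Kr)))
    ... | no _ with label-K v
    ...   | inj₁ p = ≤-trans (≤-reflexive (sym (⟦⟧-yes (label es v ≟ v) (sym p)))) (m≤m+n _ _)
    ...   | inj₂ (p , _) = ≤-trans (≤-reflexive (sym (⟦⟧-yes (K? v) p))) (m≤n+m _ _)

-- A spanning tree containing `F`, and two-edge cuts through essential edges.

module EssentialCotree (G : Multigraph) (H F : EdgeSet G)
  (connH : Connected G H) (bridgeless : ∀ e → e ∈ H → Connected G (H - e))
  (F⊆H : F ⊆ H) (acyclic : Forest G F)
  (essential : ∀ e → e ∈ H → e ∉ F → Essential G H e) where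

  open Walks G
  open Degrees G

  private
    V = Fin (n G)
    E = Fin (m G)
    a b : E → V
    a = src
    b = tgt

  open import Data.List.Membership.DecPropositional (_≟_ {m G}) using () renaming (_∈?_ to _∈ₗ?_)

  -- The greedy construction starts from `F`, so the tree contains `F` and every edge of `H` outside
  -- the tree is essential.
  open Extension (extend (forest⇒independent acyclic (elems-unique F) (∈-elems⁻)) (elems H))

  -- Abstract, since otherwise every `with` below normalises the greedy construction.
  abstract

    T : EdgeSet G
    T = ⟨ _∈ₗ? tree ⟩

    F⊆T : F ⊆ T
    F⊆T f∈F = ∈⟨⟩⁺ (_∈ₗ? tree) (⊇base (∈-elems⁺ f∈F))

    T⊆H : T ⊆ H
    T⊆H e∈T with ⊆both (∈⟨⟩⁻ (_∈ₗ? tree) e∈T)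
    ... | inj₁ i = F⊆H (∈-elems⁻ i)
    ... | inj₂ i = ∈-elems⁻ i

    connT : Connected G T
    connT u v = ~-replace (λ e e∈H → label⇒~ (∈⟨⟩⁺ (_∈ₗ? tree)) (spanning (∈-elems⁺ e∈H))) (connH u v)

    ∣T∣≤n : ∣ T ∣ ≤ n G
    ∣T∣≤n = begin
      ∣ T ∣                           ≡⟨ ∣∣≡∑ T ⟩
      sum (λ e → ⟦ e ∈? T ⟧)
        ≡⟨ sum-cong-≗ {m G} (λ e → ⟦⟧-cong (e ∈? T) (e ∈ₗ? tree) (∈⟨⟩⁻ (_∈ₗ? tree)) (∈⟨⟩⁺ (_∈ₗ? tree))) ⟩
      sum (λ e → ⟦ e ∈ₗ? tree ⟧)      ≡⟨ ∑⟦∈⟧≡length (independent⇒unique independent) ⟩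
      length tree                     ≤⟨ m≤n+m _ (roots tree) ⟩
      roots tree + length tree      ≤⟨ roots+length≤n independent ⟩
      n G                             ∎
      where open ≤-Reasoning

  D₁ D₂ : EdgeSet G
  D₁ = T ─ F
  D₂ = H ─ T

  D₂⊆H : D₂ ⊆ H
  D₂⊆H = p─q⊆p H T

  D₂∉T : ∀ {e} → e ∈ D₂ → e ∉ T
  D₂∉T = x∈p─q⇒x∉q H T

  ∣D₁∣+∣F∣≤n : ∣ D₁ ∣ + ∣ F ∣ ≤ n G
  ∣D₁∣+∣F∣≤n = begin
    ∣ D₁ ∣ + ∣ F ∣                                    ≡⟨ cong₂ _+_ (∣∣≡∑ D₁) (∣∣≡∑ F) ⟩
    sum (λ e → ⟦ e ∈? D₁ ⟧) + sum (λ e → ⟦ e ∈? F ⟧)  ≡⟨ ∑-distrib-+ {m G} _ _ ⟨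
    sum (λ e → ⟦ e ∈? D₁ ⟧ + ⟦ e ∈? F ⟧)              ≤⟨ ∑-mono {m G} pointwise ⟩
    sum (λ e → ⟦ e ∈? T ⟧)                            ≡⟨ ∣∣≡∑ T ⟨
    ∣ T ∣                                             ≤⟨ ∣T∣≤n ⟩
    n G                                               ∎
    where
    open ≤-Reasoning
    pointwise : ∀ e → ⟦ e ∈? D₁ ⟧ + ⟦ e ∈? F ⟧ ≤ ⟦ e ∈? T ⟧
    pointwise e with e ∈? F
    ... | yes e∈F = ≤-reflexive (trans (cong (_+ 1) (⟦⟧-no (e ∈? D₁) λ e∈D₁ → x∈p─q⇒x∉q T F e∈D₁ e∈F))
                                       (sym (⟦⟧-yes (e ∈? T) (F⊆T e∈F))))
    ... | no _ = ≤-trans (≤-reflexive (+-identityʳ _)) (⟦⟧-mono (e ∈? D₁) (e ∈? T) (p─q⊆p T F))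

  T⊆H-e : ∀ {e g} → e ∉ T → g ∈ T → g ∈ H - e
  T⊆H-e e∉T g∈T = x∈p∧x≢y⇒x∈p-y (T⊆H g∈T) λ { refl → e∉T g∈T }

  -- Since `H - e` is connected but not 2-edge-connected, some further deletion disconnects it. That
  -- edge must be a tree edge, for otherwise all of `T` survives.
  partner : ∀ {e} → e ∈ D₂ → ∃ λ f → f ∈ T × ¬ Connected G (H - e - f)
  partner {e} e∈D₂ with any? (λ f → (f ∈? T) ×-dec ¬? (connected? (H - e - f)))
  ... | yes found = found
  ... | no none = contradiction (Connected-mono (T⊆H-e e∉T) connT , stays-connected)
                    (essential e (D₂⊆H e∈D₂) (e∉T ∘ F⊆T))
    where
    e∉T = D₂∉T e∈D₂
    stays-connected : ∀ f → f ∈ H - e → Connected G (H - e - f)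
    stays-connected f f∈ with f ∈? T
    ... | yes f∈T = decidable-stable (connected? (H - e - f)) λ ¬c → none (f , f∈T , ¬c)
    ... | no f∉T = Connected-mono (λ g∈T → x∈p∧x≢y⇒x∈p-y (T⊆H-e e∉T g∈T) λ { refl → f∉T g∈T }) connT

  abstract

    φ : E → E
    φ e with e ∈? D₂
    ... | yes e∈D₂ = proj₁ (partner e∈D₂)
    -- A filler that makes `φ` total, so that sums may range over all edges; the statements about
    -- `φ` are restricted to `D₂`.
    ... | no _ = e

    φ-cut : ∀ {e} → e ∈ D₂ → φ e ∈ T × ¬ Connected G (H - e - φ e)
    φ-cut {e} e∈D₂ with e ∈? D₂
    ... | yes p = proj₂ (partner p)
    ... | no ¬p = contradiction e∈D₂ ¬p

  T-φ⊆ : ∀ {e g} → e ∈ D₂ → g ∈ T - φ e → g ∈ H - e - φ e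
  T-φ⊆ {e} e∈D₂ g∈ = x∈p∧x≢y⇒x∈p-y (T⊆H-e (D₂∉T e∈D₂) (x∈p-y⇒x∈p (φ e) g∈)) (x∈p-y⇒x≢y {p = T} (φ e) g∈)

  trail : ∀ e → Trail T (a e) (b e)
  trail e = walk⇒trail (proj₂ (connT (a e) (b e)))

  -- Otherwise the tree trail of `e` avoids both `e` and `φ e`. In the connected graph `H - φ e` it
  -- could replace `e`, so the pair would not be a cut.
  φ∈trail : ∀ {e} → e ∈ D₂ → φ e ∈ₗ proj₁ (trail e)
  φ∈trail {e} e∈D₂ with trail e | φ-cut e∈D₂
  ... | es , p , _ | f∈T , cut with φ e ∈ₗ? es
  ...   | yes i = i
  ...   | no f∉es = contradiction (λ u v → ~-replace reroute (bridgeless f (T⊆H f∈T) u v)) cut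
    where
    f = φ e
    reroute : ∀ g → g ∈ H - f → a g ~[ H - e - f ] b g
    reroute g g∈ with g ≟ e
    ... | yes refl = _ , restrict p λ i → T-φ⊆ e∈D₂ (x∈p∧x≢y⇒x∈p-y (walk-edges p i) λ { refl → f∉es i })
    ... | no g≢e = ~-edge (x∈p∧x≢y⇒x∈p-y (x∈p∧x≢y⇒x∈p-y (x∈p-y⇒x∈p f g∈) g≢e) (x∈p-y⇒x≢y {p = H} f g∈))

  -- Suppose `e` and `e′` differ and `φ e′` is on the trail of `e`. The rest of that trail together
  -- with `e` bypasses `φ e′` without using `e′`, so `H - e′ - φ e′` would inherit the connectivity
  -- of `T`.
  φ∈trail⇒≡ : ∀ {e e′} → e ∈ D₂ → e′ ∈ D₂ → φ e′ ∈ₗ proj₁ (trail e) → e ≡ e′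
  φ∈trail⇒≡ {e} {e′} e∈D₂ e′∈D₂ i with trail e | e ≟ e′
  ... | _ | yes e≡e′ = e≡e′
  ... | es , p , U | no e≢e′ = contradiction (λ u v → ~-replace reroute (connT u v)) (proj₂ (φ-cut e′∈D₂))
    where
    f = φ e′
    S = H - e′ - f
    e-edge : a e ~[ S ] b e
    e-edge = ~-edge (x∈p∧x≢y⇒x∈p-y (x∈p∧x≢y⇒x∈p-y (D₂⊆H e∈D₂) e≢e′)
                       λ e≡f → D₂∉T e∈D₂ (subst (_∈ T) (sym e≡f) (proj₁ (φ-cut e′∈D₂))))
    bypass : Detour T (a e) (b e) f → a f ~[ S ] b f
    bypass (inj₁ (p , q)) = ~-trans (~-sym (~-mono (T-φ⊆ e′∈D₂) p)) (~-trans e-edge (~-sym (~-mono (T-φ⊆ e′∈D₂) q)))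
    bypass (inj₂ (p , q)) = ~-trans (~-mono (T-φ⊆ e′∈D₂) q) (~-trans (~-sym e-edge) (~-mono (T-φ⊆ e′∈D₂) p))
    reroute : ∀ g → g ∈ T → a g ~[ S ] b g
    reroute g g∈T with g ≟ f
    ... | yes refl = bypass (split-trail p U i)
    ... | no g≢f = ~-edge (T-φ⊆ e′∈D₂ (x∈p∧x≢y⇒x∈p-y g∈T g≢f))

  φ-injective : ∀ {e e′} → e ∈ D₂ → e′ ∈ D₂ → φ e ≡ φ e′ → e ≡ e′
  φ-injective e∈D₂ e′∈D₂ eq = φ∈trail⇒≡ e∈D₂ e′∈D₂ (subst (_∈ₗ _) eq (φ∈trail e∈D₂))

  -- Components of the tree after deletion of all partner edges.

  image? : Decidable (λ f → ∃ λ e → e ∈ D₂ × φ e ≡ f)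
  image? f = any? λ e → (e ∈? D₂) ×-dec (φ e ≟ f)

  T₀ : EdgeSet G
  T₀ = T ─ ⟨ image? ⟩

  ∉T₀⇒image : ∀ {f} → f ∈ T → f ∉ T₀ → ∃ λ e → e ∈ D₂ × φ e ≡ f
  ∉T₀⇒image {f} f∈T f∉T₀ = decidable-stable (image? f) λ ¬im → f∉T₀ (x∈p∧x∉q⇒x∈p─q f∈T (¬im ∘ ∈⟨⟩⁻ image?))

  -- By `φ∈trail⇒≡`, the trail of `e` loses only the edge `φ e` on passing from `T` to `T₀`. Its two
  -- remaining pieces connect the ends of `e` to those of `φ e`.
  φ-parallel : ∀ {e} → e ∈ D₂ → a e ~[ T₀ ] a (φ e) × b (φ e) ~[ T₀ ] b e ⊎ a e ~[ T₀ ] b (φ e) × a (φ e) ~[ T₀ ] b e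
  φ-parallel {e} e∈D₂ = shrink (split-trail (restrict p in-T₀∪f) U (φ∈trail e∈D₂))
    where
    f = φ e
    es = proj₁ (trail e)
    p = proj₁ (proj₂ (trail e))
    U = proj₂ (proj₂ (trail e))
    in-T₀∪f : ∀ {g} → g ∈ₗ es → g ∈ T₀ ∪ ⁅ f ⁆
    in-T₀∪f {g} i with g ∈? T₀
    ... | yes g∈T₀ = x∈p∪q⁺ (inj₁ g∈T₀)
    ... | no g∉T₀ with ∉T₀⇒image (walk-edges p i) g∉T₀
    ...   | e′ , e′∈D₂ , refl with φ∈trail⇒≡ e∈D₂ e′∈D₂ i
    ...     | refl = x∈p∪q⁺ (inj₂ (x∈⁅x⁆ g))
    drop-f : (T₀ ∪ ⁅ f ⁆) - f ⊆ T₀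
    drop-f g∈ with x∈p∪q⁻ T₀ ⁅ f ⁆ (x∈p-y⇒x∈p f g∈)
    ... | inj₁ g∈T₀ = g∈T₀
    ... | inj₂ g∈f = contradiction (x∈⁅y⁆⇒x≡y f g∈f) (x∈p-y⇒x≢y {p = T₀ ∪ ⁅ f ⁆} f g∈)
    shrink : Detour (T₀ ∪ ⁅ f ⁆) (a e) (b e) f → _
    shrink (inj₁ (x , y)) = inj₁ (~-mono drop-f x , ~-mono drop-f y)
    shrink (inj₂ (x , y)) = inj₂ (~-mono drop-f x , ~-mono drop-f y)

  es₀ : List E
  es₀ = elems T₀

  component : V → V
  component = label es₀

  ~⇒component : ∀ {u v} → u ~[ T₀ ] v → component u ≡ component v
  ~⇒component = ~⇒label {es = es₀} ∈-elems⁺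

  -- Injectivity of `φ` makes the deleted part of `T` at least as large as `D₂`, and a graph with n
  -- - |D₂| edges or fewer has at least |D₂| components.
  ∣D₂∣≤roots : ∣ D₂ ∣ ≤ roots es₀
  ∣D₂∣≤roots = +-cancelʳ-≤ ∣ T₀ ∣ _ _ (begin
    ∣ D₂ ∣ + ∣ T₀ ∣                       ≡⟨ cong₂ _+_ ∣D₂∣≡∑ (∣∣≡∑ T₀) ⟩
    sum (λ f → sum (λ e → ⟦ (e ∈? D₂) ×-dec (φ e ≟ f) ⟧)) + sum (λ f → ⟦ f ∈? T₀ ⟧)
                                          ≡⟨ ∑-distrib-+ {m G} _ _ ⟨
    sum (λ f → sum (λ e → ⟦ (e ∈? D₂) ×-dec (φ e ≟ f) ⟧) + ⟦ f ∈? T₀ ⟧)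
                                          ≤⟨ ∑-mono {m G} pointwise ⟩
    sum (λ f → ⟦ f ∈? T ⟧)                ≡⟨ ∣∣≡∑ T ⟨
    ∣ T ∣                                 ≤⟨ ∣T∣≤n ⟩
    n G                                   ≤⟨ n≤roots+length es₀ ⟩
    roots es₀ + length es₀                ≡⟨ cong (roots es₀ +_) (length-elems T₀) ⟩
    roots es₀ + ∣ T₀ ∣                    ∎)
    where
    open ≤-Reasoning
    ∣D₂∣≡∑ : ∣ D₂ ∣ ≡ sum (λ f → sum (λ e → ⟦ (e ∈? D₂) ×-dec (φ e ≟ f) ⟧))
    ∣D₂∣≡∑ = begin-equality
      ∣ D₂ ∣                                                  ≡⟨ ∣∣≡∑ D₂ ⟩
      sum (λ e → ⟦ e ∈? D₂ ⟧)                                 ≡⟨ sum-cong-≗ {m G} (λ e → sym (∑-point (λ _ → ⟦ e ∈? D₂ ⟧) (φ e))) ⟩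
      sum (λ e → sum (λ f → ⟦ e ∈? D₂ ⟧ * ⟦ φ e ≟ f ⟧))
        ≡⟨ sum-cong-≗ {m G} (λ e → sum-cong-≗ {m G} λ f → sym (⟦⟧-× (e ∈? D₂) (φ e ≟ f))) ⟩
      sum (λ e → sum (λ f → ⟦ (e ∈? D₂) ×-dec (φ e ≟ f) ⟧))   ≡⟨ ∑-comm {m G} {m G} _ ⟩
      sum (λ f → sum (λ e → ⟦ (e ∈? D₂) ×-dec (φ e ≟ f) ⟧))   ∎
    pointwise : ∀ f → sum (λ e → ⟦ (e ∈? D₂) ×-dec (φ e ≟ f) ⟧) + ⟦ f ∈? T₀ ⟧ ≤ ⟦ f ∈? T ⟧
    pointwise f with image? f
    ... | yes im@(e , e∈D₂ , refl) = begin
      sum (λ e → ⟦ (e ∈? D₂) ×-dec (φ e ≟ f) ⟧) + ⟦ f ∈? T₀ ⟧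
        ≤⟨ +-mono-≤ (∑-unique {m G} (λ e → (e ∈? D₂) ×-dec (φ e ≟ f))
                       λ (x , eq) (y , eq′) → φ-injective x y (trans eq (sym eq′)))
                    (≤-reflexive (⟦⟧-no (f ∈? T₀) λ f∈T₀ → x∈p─q⇒x∉q T ⟨ image? ⟩ f∈T₀ (∈⟨⟩⁺ image? im))) ⟩
      1           ≡⟨ ⟦⟧-yes (f ∈? T) (proj₁ (φ-cut e∈D₂)) ⟨
      ⟦ f ∈? T ⟧  ∎
    ... | no ¬im = ≤-trans
      (≤-reflexive (cong (_+ ⟦ f ∈? T₀ ⟧) (∑-zero {m G} _ λ e → ⟦⟧-no ((e ∈? D₂) ×-dec (φ e ≟ f)) λ x → ¬im (e , x))))
      (⟦⟧-mono (f ∈? T₀) (f ∈? T) (p─q⊆p T ⟨ image? ⟩))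

  -- Edges leaving a single component of `T₀`.

  module _ (k : V) where

    private
      K? : ∀ v → Dec (component v ≡ k)
      K? v = component v ≟ k

    Crosses : E → Set
    Crosses e = component (a e) ≡ k × component (b e) ≢ k ⊎ component (a e) ≢ k × component (b e) ≡ k

    crosses? : Decidable Crosses
    crosses? e = (K? (a e) ×-dec ¬? (K? (b e))) ⊎-dec (¬? (K? (a e)) ×-dec K? (b e))

    φ-crosses : ∀ {e} → e ∈ D₂ → Crosses (φ e) → Crosses e
    φ-crosses e∈D₂ c with φ-parallel e∈D₂
    φ-crosses e∈D₂ c | inj₁ (x , y) with ~⇒component x | ~⇒component y
    ... | p | q rewrite p | q = c
    φ-crosses e∈D₂ c | inj₂ (x , y) with ~⇒component x | ~⇒component y
    φ-crosses e∈D₂ (inj₁ (s , t)) | inj₂ _ | p | q rewrite p | q = inj₂ (t , s)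
    φ-crosses e∈D₂ (inj₂ (s , t)) | inj₂ _ | p | q rewrite p | q = inj₁ (t , s)

    crosses⇒∉T₀ : ∀ {f} → Crosses f → f ∉ T₀
    crosses⇒∉T₀ c f∈T₀ with ~⇒component (~-edge f∈T₀)
    crosses⇒∉T₀ (inj₁ (s , t)) f∈T₀ | p = t (trans (sym p) s)
    crosses⇒∉T₀ (inj₂ (s , t)) f∈T₀ | p = s (trans p t)

    -- An `F`-edge leaving the component lies in `T` but not in `T₀`, so it is some `φ e`, and `e`
    -- leaves the component too. Different `F`-edges need different `e`, and each such `e` has an
    -- end in the component.
    F-crossings≤D₂-degree : sum (λ f → ⟦ f ∈? F ⟧ * ⟦ crosses? f ⟧) ≤ sum (λ v → ⟦ K? v ⟧ * deg G D₂ v)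
    F-crossings≤D₂-degree = begin
      sum (λ f → ⟦ f ∈? F ⟧ * ⟦ crosses? f ⟧)                              ≤⟨ ∑-mono {m G} find-e ⟩
      sum (λ f → sum (λ e → ⟦ e ∈? D₂ ⟧ * ⟦ crosses? e ⟧ * ⟦ φ e ≟ f ⟧))   ≡⟨ ∑-comm {m G} {m G} _ ⟩
      sum (λ e → sum (λ f → ⟦ e ∈? D₂ ⟧ * ⟦ crosses? e ⟧ * ⟦ φ e ≟ f ⟧))
        ≡⟨ sum-cong-≗ {m G} (λ e → ∑-point (λ _ → ⟦ e ∈? D₂ ⟧ * ⟦ crosses? e ⟧) (φ e)) ⟩
      sum (λ e → ⟦ e ∈? D₂ ⟧ * ⟦ crosses? e ⟧)
        ≤⟨ ∑-mono {m G} (λ e → *-monoʳ-≤ ⟦ e ∈? D₂ ⟧ (end-in-K e)) ⟩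
      sum (λ e → ⟦ e ∈? D₂ ⟧ * sum (λ v → ⟦ K? v ⟧ * ⟦ inc? e v ⟧))        ≡⟨ handshake (λ v → ⟦ K? v ⟧) D₂ ⟨
      sum (λ v → ⟦ K? v ⟧ * deg G D₂ v)                                    ∎
      where
      open ≤-Reasoning
      find-e : ∀ f → ⟦ f ∈? F ⟧ * ⟦ crosses? f ⟧ ≤ sum (λ e → ⟦ e ∈? D₂ ⟧ * ⟦ crosses? e ⟧ * ⟦ φ e ≟ f ⟧)
      find-e f with f ∈? F
      ... | no _ = z≤n
      ... | yes f∈F with crosses? f
      ...   | no _ = z≤n
      ...   | yes c with ∉T₀⇒image (F⊆T f∈F) (crosses⇒∉T₀ c)
      ...     | e , e∈D₂ , refl = ≤-trans
        (≤-reflexive (sym (cong₂ _*_ (cong₂ _*_ (⟦⟧-yes (e ∈? D₂) e∈D₂) (⟦⟧-yes (crosses? e) (φ-crosses e∈D₂ c)))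
                                     (⟦⟧-yes (φ e ≟ f) refl))))
        (term≤∑ (λ e → ⟦ e ∈? D₂ ⟧ * ⟦ crosses? e ⟧ * ⟦ φ e ≟ f ⟧) e)
      end-in-K : ∀ e → ⟦ crosses? e ⟧ ≤ sum (λ v → ⟦ K? v ⟧ * ⟦ inc? e v ⟧)
      end-in-K e with crosses? e
      ... | no _ = z≤n
      ... | yes (inj₁ (s , _)) = ≤-trans (≤-reflexive (sym (⟦⟧-yes (K? (a e)) s))) (≤∑inc (λ v → ⟦ K? v ⟧) e (inj₁ refl))
      ... | yes (inj₂ (_ , t)) = ≤-trans (≤-reflexive (sym (⟦⟧-yes (K? (b e)) t))) (≤∑inc (λ v → ⟦ K? v ⟧) e (inj₂ refl))

    -- The `F`-degrees in the component K sum to at least 2|K|. Inner edges contribute at most 2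
    -- each and number at most |K| - 1, so at least two `F`-edges leave K.
    2≤D₂-degree : component k ≡ k → (∀ v → component v ≡ k → 2 ≤ deg G F v) →
      2 ≤ sum (λ v → ⟦ K? v ⟧ * deg G D₂ v)
    2≤D₂-degree k-root deg≥2 = ≤-trans (+-cancelˡ-≤ (2 * inner) _ _ (begin
      2 * inner + 2                                   ≡⟨ lem inner ⟩
      2 * suc inner                                   ≤⟨ *-monoʳ-≤ 2 (forest-induced acyclic K? k-root) ⟩
      2 * sum (λ v → ⟦ K? v ⟧)                        ≡⟨ *-comm 2 (sum (λ v → ⟦ K? v ⟧)) ⟩
      sum (λ v → ⟦ K? v ⟧) * 2                        ≡⟨ *-distribʳ-sum {n G} 2 _ ⟩
      sum (λ v → ⟦ K? v ⟧ * 2)                        ≤⟨ ∑-mono {n G} (λ v → ⟦⟧*-mono (K? v) (deg≥2 v)) ⟩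
      sum (λ v → ⟦ K? v ⟧ * deg G F v)                ≡⟨ handshake (λ v → ⟦ K? v ⟧) F ⟩
      sum (λ f → ⟦ f ∈? F ⟧ * sum (λ v → ⟦ K? v ⟧ * ⟦ inc? f v ⟧))
        ≤⟨ ∑-mono {m G} pointwise ⟩
      sum (λ f → 2 * (⟦ f ∈? F ⟧ * (⟦ K? (a f) ⟧ * ⟦ K? (b f) ⟧)) + ⟦ f ∈? F ⟧ * ⟦ crosses? f ⟧)
        ≡⟨ ∑-distrib-+ {m G} _ _ ⟩
      sum (λ f → 2 * (⟦ f ∈? F ⟧ * (⟦ K? (a f) ⟧ * ⟦ K? (b f) ⟧))) + sum (λ f → ⟦ f ∈? F ⟧ * ⟦ crosses? f ⟧)
        ≡⟨ cong (_+ sum (λ f → ⟦ f ∈? F ⟧ * ⟦ crosses? f ⟧)) (*-distribˡ-sum {m G} 2 _) ⟨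
      2 * inner + sum (λ f → ⟦ f ∈? F ⟧ * ⟦ crosses? f ⟧) ∎)) F-crossings≤D₂-degree
      where
      open ≤-Reasoning
      inner = sum (λ f → ⟦ f ∈? F ⟧ * (⟦ K? (a f) ⟧ * ⟦ K? (b f) ⟧))
      lem : ∀ x → 2 * x + 2 ≡ 2 * suc x
      lem = solve-∀
      distrib : ∀ x y z → x * (2 * y + z) ≡ 2 * (x * y) + x * z
      distrib = solve-∀
      ends-in-K : ∀ f → ⟦ K? (a f) ⟧ + ⟦ K? (b f) ⟧ ≤ 2 * (⟦ K? (a f) ⟧ * ⟦ K? (b f) ⟧) + ⟦ crosses? f ⟧
      ends-in-K f with K? (a f) | K? (b f)
      ... | yes _ | yes _ = ≤-refl
      ... | yes _ | no _ = ≤-refl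
      ... | no _ | yes _ = ≤-refl
      ... | no _ | no _ = ≤-refl
      pointwise : ∀ f → ⟦ f ∈? F ⟧ * sum (λ v → ⟦ K? v ⟧ * ⟦ inc? f v ⟧) ≤
        2 * (⟦ f ∈? F ⟧ * (⟦ K? (a f) ⟧ * ⟦ K? (b f) ⟧)) + ⟦ f ∈? F ⟧ * ⟦ crosses? f ⟧
      pointwise f = ≤-trans (*-monoʳ-≤ ⟦ f ∈? F ⟧ (≤-trans (∑inc≤ (λ v → ⟦ K? v ⟧) f) (ends-in-K f)))
        (≤-reflexive (distrib ⟦ f ∈? F ⟧ _ _))

  -- Charging nodes to components and bounding degrees on `A`.

  module _ (A : NodeSet G) (deg≥2 : ∀ v → v ∉ A → 2 ≤ deg G F v) where

    private
      g : V → ℕ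
      g v = 2 * ⟦ v ∈? A ⟧ + ⟦ ¬? (v ∈? A) ⟧ * deg G D₂ v

    -- The charge `g` gives every component at least 2: a single node of `A` supplies it, and a
    -- component without such a node gets it from `2≤D₂-degree`.
    root-weight : ∀ k → 2 * ⟦ component k ≟ k ⟧ ≤ sum (λ v → g v * ⟦ component v ≟ k ⟧)
    root-weight k with component k ≟ k
    ... | no _ = z≤n
    ... | yes k-root with any? (λ v → (v ∈? A) ×-dec (component v ≟ k))
    ...   | yes (v , v∈A , v∈K) = begin
      2                                        ≡⟨ cong (2 *_) (⟦⟧-yes (v ∈? A) v∈A) ⟨
      2 * ⟦ v ∈? A ⟧                           ≤⟨ m≤m+n _ _ ⟩
      g v                                      ≡⟨ *-identityʳ _ ⟨
      g v * 1                                  ≡⟨ cong (g v *_) (⟦⟧-yes (component v ≟ k) v∈K) ⟨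
      g v * ⟦ component v ≟ k ⟧                ≤⟨ term≤∑ (λ v → g v * ⟦ component v ≟ k ⟧) v ⟩
      sum (λ v → g v * ⟦ component v ≟ k ⟧)    ∎
      where open ≤-Reasoning
    ...   | no none = begin
      2                                            ≤⟨ 2≤D₂-degree k k-root (λ v v∈K → deg≥2 v (v∉A v∈K)) ⟩
      sum (λ v → ⟦ component v ≟ k ⟧ * deg G D₂ v) ≤⟨ ∑-mono {n G} pointwise ⟩
      sum (λ v → g v * ⟦ component v ≟ k ⟧)        ∎
      where
      open ≤-Reasoning
      v∉A : ∀ {v} → component v ≡ k → v ∉ A
      v∉A v∈K v∈A = none (_ , v∈A , v∈K)
      pointwise : ∀ v → ⟦ component v ≟ k ⟧ * deg G D₂ v ≤ g v * ⟦ component v ≟ k ⟧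
      pointwise v with component v ≟ k
      ... | no _ = z≤n
      ... | yes v∈K = begin
        1 * deg G D₂ v                    ≡⟨ cong (_* deg G D₂ v) (⟦⟧-yes (¬? (v ∈? A)) (v∉A v∈K)) ⟨
        ⟦ ¬? (v ∈? A) ⟧ * deg G D₂ v      ≤⟨ m≤n+m _ _ ⟩
        g v                               ≡⟨ *-identityʳ _ ⟨
        g v * 1                           ∎

    2∣D₂∣≤ : 2 * ∣ D₂ ∣ ≤ 2 * ∣ A ∣ + sum (λ v → ⟦ ¬? (v ∈? A) ⟧ * deg G D₂ v)
    2∣D₂∣≤ = begin
      2 * ∣ D₂ ∣                                                     ≤⟨ *-monoʳ-≤ 2 ∣D₂∣≤roots ⟩
      2 * roots es₀                                                  ≡⟨ *-distribˡ-sum {n G} 2 _ ⟩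
      sum (λ k → 2 * ⟦ component k ≟ k ⟧)                            ≤⟨ ∑-mono {n G} root-weight ⟩
      sum (λ k → sum (λ v → g v * ⟦ component v ≟ k ⟧))              ≡⟨ ∑-comm {n G} {n G} _ ⟩
      sum (λ v → sum (λ k → g v * ⟦ component v ≟ k ⟧))
        -- Each node pays its charge to its own component only.
        ≡⟨ sum-cong-≗ {n G} (λ v → ∑-point (λ _ → g v) (component v)) ⟩
      sum g                                                          ≡⟨ ∑-distrib-+ {n G} _ _ ⟩
      sum (λ v → 2 * ⟦ v ∈? A ⟧) + sum (λ v → ⟦ ¬? (v ∈? A) ⟧ * deg G D₂ v)
        ≡⟨ cong (_+ sum (λ v → ⟦ ¬? (v ∈? A) ⟧ * deg G D₂ v))
             (trans (sym (*-distribˡ-sum {n G} 2 _)) (cong (2 *_) (sym (∣∣≡∑ A)))) ⟩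
      2 * ∣ A ∣ + sum (λ v → ⟦ ¬? (v ∈? A) ⟧ * deg G D₂ v)           ∎
      where open ≤-Reasoning

    -- The `D₂`-degrees outside `A` enter both the handshake bound and the charge bound with
    -- coefficient 1, so they cancel.
    ∑D₂≤ : sum (λ v → ⟦ v ∈? A ⟧ * deg G D₂ v) ≤ 2 * ∣ A ∣
    ∑D₂≤ = +-cancelʳ-≤ (sum (λ v → ⟦ ¬? (v ∈? A) ⟧ * deg G D₂ v)) _ _ (begin
      sum (λ v → ⟦ v ∈? A ⟧ * deg G D₂ v) + sum (λ v → ⟦ ¬? (v ∈? A) ⟧ * deg G D₂ v)
        ≡⟨ ∑-distrib-+ {n G} _ _ ⟨
      sum (λ v → ⟦ v ∈? A ⟧ * deg G D₂ v + ⟦ ¬? (v ∈? A) ⟧ * deg G D₂ v)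
        ≡⟨ sum-cong-≗ {n G} split ⟩
      sum (deg G D₂)   ≤⟨ ∑deg≤ D₂ ⟩
      2 * ∣ D₂ ∣       ≤⟨ 2∣D₂∣≤ ⟩
      2 * ∣ A ∣ + sum (λ v → ⟦ ¬? (v ∈? A) ⟧ * deg G D₂ v) ∎)
      where
      open ≤-Reasoning
      split : ∀ v → ⟦ v ∈? A ⟧ * deg G D₂ v + ⟦ ¬? (v ∈? A) ⟧ * deg G D₂ v ≡ deg G D₂ v
      split v with v ∈? A
      ... | yes _ = trans (+-identityʳ _) (*-identityˡ _)
      ... | no _ = *-identityˡ _

    -- Edges of `D₁` are counted at all nodes, those of `D₂` only at nodes of `A`. Adding 2|F|
    -- completes `D₁` to the whole tree, which costs at most 2n.
    essential-degree-sum : sum (λ v → ⟦ v ∈? A ⟧ * deg G (H ─ F) v) + 2 * ∣ F ∣ ≤ 2 * n G + 2 * ∣ A ∣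
    essential-degree-sum = begin
      sum (λ v → ⟦ v ∈? A ⟧ * deg G (H ─ F) v) + 2 * ∣ F ∣
        ≤⟨ +-monoˡ-≤ (2 * ∣ F ∣) (∑-mono {n G} pointwise) ⟩
      sum (λ v → deg G D₁ v + ⟦ v ∈? A ⟧ * deg G D₂ v) + 2 * ∣ F ∣
        ≡⟨ cong (_+ 2 * ∣ F ∣) (∑-distrib-+ {n G} _ _) ⟩
      sum (deg G D₁) + sum (λ v → ⟦ v ∈? A ⟧ * deg G D₂ v) + 2 * ∣ F ∣
        ≤⟨ +-monoˡ-≤ (2 * ∣ F ∣) (+-mono-≤ (∑deg≤ D₁) ∑D₂≤) ⟩
      2 * ∣ D₁ ∣ + 2 * ∣ A ∣ + 2 * ∣ F ∣        ≡⟨ lem (∣ D₁ ∣) (∣ A ∣) (∣ F ∣) ⟩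
      2 * (∣ D₁ ∣ + ∣ F ∣) + 2 * ∣ A ∣          ≤⟨ +-monoˡ-≤ (2 * ∣ A ∣) (*-monoʳ-≤ 2 ∣D₁∣+∣F∣≤n) ⟩
      2 * n G + 2 * ∣ A ∣                       ∎
      where
      open ≤-Reasoning
      lem : ∀ x y z → 2 * x + 2 * y + 2 * z ≡ 2 * (x + z) + 2 * y
      lem = solve-∀
      H─F⊆ : ∀ {e} → e ∈ H ─ F → e ∈ D₁ ⊎ e ∈ D₂
      H─F⊆ {e} e∈ with e ∈? T
      ... | yes e∈T = inj₁ (x∈p∧x∉q⇒x∈p─q e∈T (x∈p─q⇒x∉q H F e∈))
      ... | no e∉T = inj₂ (x∈p∧x∉q⇒x∈p─q (p─q⊆p H F e∈) e∉T)
      pointwise : ∀ v → ⟦ v ∈? A ⟧ * deg G (H ─ F) v ≤ deg G D₁ v + ⟦ v ∈? A ⟧ * deg G D₂ v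
      pointwise v = begin
        ⟦ v ∈? A ⟧ * deg G (H ─ F) v                              ≤⟨ *-monoʳ-≤ ⟦ v ∈? A ⟧ (deg-≤ H─F⊆ v) ⟩
        ⟦ v ∈? A ⟧ * (deg G D₁ v + deg G D₂ v)                    ≡⟨ *-distribˡ-+ ⟦ v ∈? A ⟧ _ _ ⟩
        ⟦ v ∈? A ⟧ * deg G D₁ v + ⟦ v ∈? A ⟧ * deg G D₂ v         ≤⟨ +-monoˡ-≤ _ (⟦⟧*≤ (v ∈? A) (deg G D₁ v)) ⟩
        deg G D₁ v + ⟦ v ∈? A ⟧ * deg G D₂ v                      ∎

-- Nodes of `F`-degree at most one.

∣p∣≡1⇒unique : ∀ {k} {p : Subset k} {x y} → ∣ p ∣ ≡ 1 → x ∈ p → y ∈ p → x ≡ y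
∣p∣≡1⇒unique {p = p} {x} {y} ∣p∣≡1 x∈p y∈p with y ≟ x
... | yes y≡x = sym y≡x
... | no y≢x = contradiction
  (≤-trans (s≤s (x∈p⇒∣p-x∣<∣p∣ (x∈p∧x≢y⇒x∈p-y y∈p y≢x))) (≤-trans (x∈p⇒∣p-x∣<∣p∣ x∈p) (≤-reflexive ∣p∣≡1)))
  λ { (s≤s ()) }

module LowDegree (G : Multigraph) (E' F : EdgeSet G) where

  open Degrees G

  lookup-L : ∀ v → lookup (L G E' F) v ≡
    (deg G F v ==0) ∨ (((deg G F v ==1) ∧ ⌊ δ G F v ⊆? E' ⌋) ∨ ((deg G F v ==1) ∧ not ⌊ nonempty? (δ G F v ∩ E') ⌋))
  lookup-L v = trans (lookup∘tabulate _ v)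
    (cong₂ _∨_ (lookup∘tabulate _ v) (cong₂ _∨_ (lookup∘tabulate _ v) (lookup∘tabulate _ v)))

  -- A single incident `F`-edge is either in `E'` or not, which puts its node into `L₁` or `L₂`.
  ∉L⇒2≤deg : ∀ v → v ∉ L G E' F → 2 ≤ deg G F v
  ∉L⇒2≤deg v v∉L with deg G F v in d | δ G F v ⊆? E' | nonempty? (δ G F v ∩ E') | lookup-L v
  ... | suc (suc _) | _ | _ | _ = s≤s (s≤s z≤n)
  ... | zero | _ | _ | eq = contradiction (lookup⇒[]= v _ eq) v∉L
  ... | suc zero | yes _ | _ | eq = contradiction (lookup⇒[]= v _ eq) v∉L
  ... | suc zero | no _ | no _ | eq = contradiction (lookup⇒[]= v _ eq) v∉L
  ... | suc zero | no δ⊈ | yes (x , x∈) | _ = contradiction (λ {y} → δ⊆E' {y}) δ⊈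
    where
    δ⊆E' : δ G F v ⊆ E'
    δ⊆E' y∈δ = let (x∈δ , x∈E') = x∈p∩q⁻ (δ G F v) E' x∈ in subst (_∈ E') (∣p∣≡1⇒unique d x∈δ y∈δ) x∈E'

  -- At a node of `L₀` or `L₂` no `F`-edge belongs to `E'`; at a node of `L₁` there is just one
  -- `F`-edge.
  deg-∩≤ : ∀ v → v ∈ L G E' F → deg G (E' ∩ F) v ≤ ⟦ v ∈? L₁ G E' F ⟧
  deg-∩≤ v v∈L = ≤-trans (p⊆q⇒∣p∣≤∣q∣ δ∩⊆) bound
    where
    δ∩⊆ : δ G (E' ∩ F) v ⊆ δ G F v ∩ E'
    δ∩⊆ e∈ = let (e∈∩ , i) = ∈δ⁻ e∈ ; (e∈E' , e∈F) = x∈p∩q⁻ E' F e∈∩ in x∈p∩q⁺ (∈δ⁺ e∈F i , e∈E')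
    bound : ∣ δ G F v ∩ E' ∣ ≤ ⟦ v ∈? L₁ G E' F ⟧
    bound with nonempty? (δ G F v ∩ E') in ne
    ... | no empty = ≤-trans (≤-reflexive (trans (cong ∣_∣ (Empty-unique empty)) (∣⊥∣≡0 (m G)))) z≤n
    ... | yes _ with deg G F v in d | δ G F v ⊆? E' in sub | trans (sym (lookup-L v)) ([]=⇒lookup v∈L)
    ...   | zero | _ | _ = ≤-trans (∣p∩q∣≤∣p∣ (δ G F v) E') (≤-trans (≤-reflexive d) z≤n)
    ...   | suc zero | yes _ | _ = ≤-trans (∣p∩q∣≤∣p∣ (δ G F v) E') (≤-reflexive (trans d (sym (⟦⟧-yes (v ∈? L₁ G E' F) v∈L₁))))
      where
      v∈L₁ : v ∈ L₁ G E' F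
      v∈L₁ = lookup⇒[]= v _ (trans (lookup∘tabulate _ v) (cong₂ _∧_ (cong _==1 d) (cong ⌊_⌋ sub)))
    -- Degree one and failure of the `L₁` test leave only `L₂`, which contradicts the common edge
    -- found by `ne`.
    ...   | suc zero | no _ | eq = contradiction (trans (sym eq) (cong (λ x → not ⌊ x ⌋) ne)) λ ()
    ...   | suc (suc _) | _ | ()

  -- The shortfall of deg_F below 2 is at most one on `L`, plus one more on `L₀`, which is contained
  -- in `L`.
  deg-budget : ∀ v → 2 ≤ deg G F v + (⟦ v ∈? L G E' F ⟧ + ⟦ v ∈? L₀ G E' F ⟧)
  deg-budget v with v ∈? L G E' F
  ... | no v∉L = ≤-trans (∉L⇒2≤deg v v∉L) (m≤m+n _ _)
  ... | yes _ with deg G F v in d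
  ...   | suc d′ = s≤s (≤-trans (s≤s z≤n) (m≤n+m _ d′))
  ...   | zero = s≤s (≤-reflexive (sym (⟦⟧-yes (v ∈? L₀ G E' F)
                   (lookup⇒[]= v _ (trans (lookup∘tabulate _ v) (cong _==0 d))))))

-- Combination of the counts for `H = E' ∪ F`.

theorem8 : (G : Multigraph) → TwoEdgeConnected G ⊤ →
    (E' : EdgeSet G) → E' ⊆ ⊤ → Minimal2ECSS G E' →
    (F : EdgeSet G) → F ⊆ ⊤ → Forest G F →
    (∀ e → e ∈ E' → e ∉ F → Essential G (E' ∪ F) e) →
    sumOver G (L G E' F) (deg G E') ≤ 3 * (∣ L G E' F ∣ + ∣ L₀ G E' F ∣) + ∣ L₁ G E' F ∣
theorem8 G _ E' _ ((conn , conn-) , _) F _ acyclic essential = begin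
  sumOver G (L G E' F) (deg G E')                        ≡⟨ sum-map-allFin {n G} _ ⟩
  sum (λ v → if lookup (L G E' F) v then deg G E' v else 0)
    ≤⟨ ∑-mono {n G} pointwise ⟩
  sum (λ v → ⟦ v ∈? L G E' F ⟧ * deg G (H ─ F) v + ⟦ v ∈? L₁ G E' F ⟧)
    ≡⟨ ∑-distrib-+ {n G} _ _ ⟩
  X + sum (λ v → ⟦ v ∈? L₁ G E' F ⟧)                     ≡⟨ cong (X +_) (∣∣≡∑ (L₁ G E' F)) ⟨
  X + l₁                                                 ≤⟨ +-monoˡ-≤ l₁ X≤ ⟩
  3 * (l + l₀) + l₁                                      ∎
  where
  open ≤-Reasoning
  open Degrees G
  open LowDegree G E' F
  open Walks G using (Connected-mono)
  H = E' ∪ F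
  l = ∣ L G E' F ∣
  l₀ = ∣ L₀ G E' F ∣
  l₁ = ∣ L₁ G E' F ∣
  X = sum (λ v → ⟦ v ∈? L G E' F ⟧ * deg G (H ─ F) v)

  -- Deleting an edge of `E'` leaves the rest of `E'` connected; deleting any other edge leaves `E'`
  -- intact.
  bridgeless : ∀ e → e ∈ H → Connected G (H - e)
  bridgeless e _ with e ∈? E'
  ... | yes e∈E' = Connected-mono (λ g∈ → x∈p∧x≢y⇒x∈p-y (p⊆p∪q F (x∈p-y⇒x∈p e g∈)) (x∈p-y⇒x≢y {p = E'} e g∈)) (conn- e e∈E')
  ... | no e∉E' = Connected-mono (λ g∈ → x∈p∧x≢y⇒x∈p-y (p⊆p∪q F g∈) λ { refl → e∉E' g∈ }) conn

  essential-H : ∀ e → e ∈ H → e ∉ F → Essential G H e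
  essential-H e e∈H e∉F with x∈p∪q⁻ E' F e∈H
  ... | inj₁ e∈E' = essential e e∈E' e∉F
  ... | inj₂ e∈F = contradiction e∈F e∉F

  E'⊆ : ∀ {e} → e ∈ E' → e ∈ H ─ F ⊎ e ∈ E' ∩ F
  E'⊆ {e} e∈E' with e ∈? F
  ... | yes e∈F = inj₂ (x∈p∩q⁺ (e∈E' , e∈F))
  ... | no e∉F = inj₁ (x∈p∧x∉q⇒x∈p─q (p⊆p∪q F e∈E') e∉F)

  -- The `E'`-edges at `v` outside `F` go into `X`; those inside `F` produce the separate summand
  -- |L₁|.
  pointwise : ∀ v → (if lookup (L G E' F) v then deg G E' v else 0) ≤
    ⟦ v ∈? L G E' F ⟧ * deg G (H ─ F) v + ⟦ v ∈? L₁ G E' F ⟧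
  pointwise v with lookup (L G E' F) v in eq
  ... | false = z≤n
  ... | true = begin
    deg G E' v                                      ≤⟨ deg-≤ E'⊆ v ⟩
    deg G (H ─ F) v + deg G (E' ∩ F) v              ≤⟨ +-monoʳ-≤ (deg G (H ─ F) v) (deg-∩≤ v v∈L) ⟩
    deg G (H ─ F) v + ⟦ v ∈? L₁ G E' F ⟧            ≡⟨ cong (_+ ⟦ v ∈? L₁ G E' F ⟧) (*-identityˡ (deg G (H ─ F) v)) ⟨
    1 * deg G (H ─ F) v + ⟦ v ∈? L₁ G E' F ⟧
      ≡⟨ cong (λ x → x * deg G (H ─ F) v + ⟦ v ∈? L₁ G E' F ⟧) (⟦⟧-yes (v ∈? L G E' F) v∈L) ⟨
    ⟦ v ∈? L G E' F ⟧ * deg G (H ─ F) v + ⟦ v ∈? L₁ G E' F ⟧ ∎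
    where
    v∈L : v ∈ L G E' F
    v∈L = lookup⇒[]= v _ eq

  2n≤ : 2 * n G ≤ 2 * ∣ F ∣ + (l + l₀)
  2n≤ = begin
    2 * n G                                   ≡⟨ *-comm 2 (n G) ⟩
    n G * 2                                   ≡⟨ ∑-const (n G) 2 ⟨
    sum {n G} (λ _ → 2)                       ≤⟨ ∑-mono {n G} deg-budget ⟩
    sum (λ v → deg G F v + (⟦ v ∈? L G E' F ⟧ + ⟦ v ∈? L₀ G E' F ⟧))
      ≡⟨ trans (∑-distrib-+ {n G} _ _) (cong (sum (deg G F) +_) (∑-distrib-+ {n G} _ _)) ⟩
    sum (deg G F) + (sum (λ v → ⟦ v ∈? L G E' F ⟧) + sum (λ v → ⟦ v ∈? L₀ G E' F ⟧))
      ≤⟨ +-mono-≤ (∑deg≤ F) (≤-reflexive (cong₂ _+_ (sym (∣∣≡∑ (L G E' F))) (sym (∣∣≡∑ (L₀ G E' F))))) ⟩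
    2 * ∣ F ∣ + (l + l₀)                      ∎

  X≤ : X ≤ 3 * (l + l₀)
  X≤ = +-cancelʳ-≤ (2 * ∣ F ∣) _ _ (begin
    X + 2 * ∣ F ∣                        ≤⟨ EssentialCotree.essential-degree-sum G H F
                                              (Connected-mono (p⊆p∪q F) conn) bridgeless (q⊆p∪q E' F) acyclic essential-H
                                              (L G E' F) ∉L⇒2≤deg ⟩
    -- The factor 3 arises here: one copy of `l + l₀` covers the gap between 2n and 2|F|, two copies
    -- cover the `D₂`-edges.
    2 * n G + 2 * l                      ≤⟨ +-mono-≤ 2n≤ (*-monoʳ-≤ 2 (m≤m+n l l₀)) ⟩
    2 * ∣ F ∣ + (l + l₀) + 2 * (l + l₀)  ≡⟨ collect (∣ F ∣) (l + l₀) ⟩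
    3 * (l + l₀) + 2 * ∣ F ∣             ∎)
    where
    collect : ∀ x y → 2 * x + y + 2 * y ≡ 3 * y + 2 * x
    collect = solve-∀
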